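{- Let $n\ge 0$ be an integer. If there exists a graph $G$ that is cospectral with the double star $P_2(1,n)$ but not isomorphic to $P_2(1,n)$, then $n$ is even.
   Context: All graphs are finite, simple and undirected. The spectrum of a graph is the multiset of eigenvalues of its adjacency matrix; two graphs are cospectral if they have the same spectrum. For integers $a,b\ge 0$, the double star $P_2(a,b)$ is the tree obtained from the stars $K_{1,a}$ and $K_{1,b}$ by adding an edge between their center vertices. -}

module Defs where

open import Data.Bool using (Bool; true; false; _∨_; _∧_; not)
open import Data.Nat as ℕ using (ℕ; zero; suc)
open import Data.Integer as ℤ using (ℤ; +_; -_)
open import Data.Fin using (Fin; zero; suc; toℕ; punchIn)
open import Data.List using (List; []; _∷_; reverse)
open import Relation.Binary.PropositionalEquality using (_≡_)
open import Relation.Nullary using (yes; no)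
open import Data.Product using (Σ)
open import Function.Bundles using (_↔_; Inverse)

record Graph (n : ℕ) : Set where
  field
    adj   : Fin n → Fin n → Bool
    sym   : ∀ i j → adj i j ≡ adj j i
    irrefl : ∀ i → adj i i ≡ false
open Graph public

Isomorphic : ∀ {m k} → Graph m → Graph k → Set
Isomorphic {m} {k} G H =
  Σ (Fin m ↔ Fin k) λ φ →
    ∀ i j → adj G i j ≡ adj H (Inverse.to φ i) (Inverse.to φ j)

-- Univariate polynomials over ℤ as coefficient lists (constant term first)

Poly : Set
Poly = List ℤ

_+ₚ_ : Poly → Poly → Poly
[] +ₚ q = q
(a ∷ p) +ₚ [] = a ∷ p
(a ∷ p) +ₚ (b ∷ q) = (a ℤ.+ b) ∷ (p +ₚ q)

scaleₚ : ℤ → Poly → Poly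
scaleₚ c [] = []
scaleₚ c (a ∷ p) = (c ℤ.* a) ∷ scaleₚ c p

_*ₚ_ : Poly → Poly → Poly
[] *ₚ q = []
(a ∷ p) *ₚ q = scaleₚ a q +ₚ (+ 0 ∷ (p *ₚ q))

negₚ : Poly → Poly
negₚ = scaleₚ (- (+ 1))

dropZeros : List ℤ → List ℤ
dropZeros [] = []
dropZeros (a ∷ p) with a ℤ.≟ + 0
... | yes _ = dropZeros p
... | no _  = a ∷ p

normalise : Poly → Poly
normalise p = reverse (dropZeros (reverse p))

sumFin : ∀ {n} → (Fin n → Poly) → Poly
sumFin {zero} f = []
sumFin {suc n} f = f zero +ₚ sumFin (λ i → f (suc i))

det : ∀ n → (Fin n → Fin n → Poly) → Poly
det zero M = + 1 ∷ []
det (suc n) M =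
  sumFin λ j →
    let t = M zero j *ₚ det n (λ r c → M (suc r) (punchIn j c))
    in signed (toℕ j) t
  where
  signed : ℕ → Poly → Poly
  signed zero p = p
  signed (suc zero) p = negₚ p
  signed (suc (suc k)) p = signed k p

adjMatrix : ∀ {n} → Graph n → Fin n → Fin n → ℤ
adjMatrix G i j with adj G i j
... | true  = + 1
... | false = + 0

charEntry : ∀ {n} → Graph n → Fin n → Fin n → Poly
charEntry G i j with i Data.Fin.≟ j
... | yes _ = (- adjMatrix G i j) ∷ + 1 ∷ []
... | no _  = (- adjMatrix G i j) ∷ []

charPoly : ∀ {n} → Graph n → Poly
charPoly {n} G = normalise (det n (charEntry G))

Cospectral : ∀ {m k} → Graph m → Graph k → Set
Cospectral G H = charPoly G ≡ charPoly H

-- The double star P₂(1,n) on vertex set Fin (n + 3):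
-- vertex 0 = centre of K_{1,1}, vertex 1 = centre of K_{1,n},
-- vertex 2 = leaf of centre 0, vertices 3 … n+2 = leaves of centre 1.

dsBase : ℕ → ℕ → Bool
dsBase 0 1 = true
dsBase 0 2 = true
dsBase 1 (suc (suc (suc _))) = true
dsBase _ _ = false

dsEdge : ℕ → ℕ → Bool
dsEdge a b = dsBase a b ∨ dsBase b a

private
  ∨-comm : ∀ x y → (x ∨ y) ≡ (y ∨ x)
  ∨-comm false false = _≡_.refl
  ∨-comm false true = _≡_.refl
  ∨-comm true false = _≡_.refl
  ∨-comm true true = _≡_.refl

  dsBase-irr : ∀ a → dsBase a a ≡ false
  dsBase-irr 0 = _≡_.refl
  dsBase-irr 1 = _≡_.refl
  dsBase-irr (suc (suc a)) = _≡_.refl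

  dsEdge-irr : ∀ a → dsEdge a a ≡ false
  dsEdge-irr 0 = _≡_.refl
  dsEdge-irr 1 = _≡_.refl
  dsEdge-irr (suc (suc a)) = _≡_.refl

doubleStar1 : (n : ℕ) → Graph (n ℕ.+ 3)
doubleStar1 n = record
  { adj = λ i j → dsEdge (toℕ i) (toℕ j)
  ; sym = λ i j → ∨-comm (dsBase (toℕ i) (toℕ j)) (dsBase (toℕ j) (toℕ i))
  ; irrefl = λ i → dsEdge-irr (toℕ i)
  }

{-# OPTIONS --safe #-}
module Submission where

-- The coefficients of the characteristic polynomial are the sums of the principal minors of −A of
-- each order. For the double star, hence for G, they vanish in the orders 3, 5 and 6 and are
-- −(n + 2) and n in the orders 2 and 4.
-- In any graph the minors of order 3 are ≤ 0, so here all of them vanish; granted this, the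
-- minors of order 5 are ≤ 0 and vanish too, and then so do those of order 6.
-- Some minor of order 4 does not vanish, and its vertices induce a path or a perfect matching.
-- As the minors of order 6 containing it vanish, the adjacency of two vertices depends only on
-- their neighbours among those four, and G is a blow-up of the path P₅, with class
-- sizes a, b, c, d, e (possibly 0), together with isolated vertices. The remaining two sums become
--   ab + bc + cd + de = n + 2,   bd(ac + ce + ae) = n,
-- and for odd n these only have the solutions given by the double star.

open import Defs hiding (sym)
open import Data.Bool using (Bool; true; false; if_then_else_; _∨_; _∧_; not)
open import Data.Bool.ListAction using (all)
import Data.Bool.Properties as Boolₚ
open import Data.Empty using (⊥-elim)
open import Data.Fin as Fin using (Fin; zero; suc; toℕ; punchIn)
open import Data.Fin.Patterns
open import Data.Fin.Permutation using (cast-id; _∘ₚ_)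
import Data.Fin.Properties as Finₚ
open import Data.Integer as ℤ using (ℤ; +_; -[1+_]; 0ℤ; 1ℤ)
import Data.Integer.Properties as ℤₚ
open import Data.Integer.Solver using (module +-*-Solver)
open import Data.Integer.Tactic.RingSolver using (solve-∀)
open import Data.List as List using (List; []; _∷_; _++_; allFin; length; map; replicate; reverse; tabulate)
open import Data.List.Membership.Propositional using (_∈_)
import Data.List.Membership.Propositional.Properties as Memₚ
import Data.List.Properties as Listₚ
open import Data.List.Relation.Binary.Permutation.Homogeneous using (onIndices)
open import Data.List.Relation.Binary.Permutation.Propositional as Perm using (_↭_; ↭-refl; ↭-sym; ↭-trans; prep; swap)
import Data.List.Relation.Binary.Permutation.Propositional.Properties as Permₚ
import Data.List.Relation.Binary.Permutation.Setoid.Properties as PermSetoidₚ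
open import Data.List.Relation.Unary.All as All using (All; []; _∷_)
open import Data.List.Relation.Unary.AllPairs using ([]; _∷_)
open import Data.List.Relation.Unary.Any as Any using (Any; here; there)
open import Data.List.Relation.Unary.Unique.Propositional using (Unique)
import Data.List.Relation.Unary.Unique.Propositional.Properties as Uniqueₚ
open import Data.Nat as ℕ using (ℕ; zero; suc; s≤s)
open import Data.Nat.Divisibility using (_∣_; _∣?_; divides; ∣m⇒∣m*n; ∣n⇒∣m*n)
import Data.Nat.Properties as ℕₚ
import Data.Nat.Tactic.RingSolver as ℕ-Ring
open import Data.Product using (_×_; _,_; proj₁; proj₂; ∃)
open import Data.Product.Properties using () renaming (≡-dec to ×-≡-dec)
open import Data.Sum using (_⊎_; inj₁; inj₂; [_,_]′)
open import Data.Unit using (⊤; tt)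
import Data.Unit.Properties as Unitₚ
open import Data.Vec as Vec using (Vec; []; _∷_; fromList)
import Data.Vec.Properties as Vecₚ
open import Function using (_∘_)
open import Function.Bundles using (_↔_; Inverse)
open import Relation.Binary using (DecidableEquality)
open import Relation.Binary.PropositionalEquality using (_≡_; _≢_; _≗_; refl; sym; trans; cong; cong₂; subst; subst₂; setoid; module ≡-Reasoning)
open import Relation.Nullary using (¬_; Dec; does; yes; no; contradiction; _⊎-dec_)
open import Relation.Nullary.Decidable using (from-yes; decidable-stable)

-- That adjacency depends only on neighbours among the four is a Schur complement argument: over a
-- nonsingular block of order 4 the minors of order 5 make the diagonal of the complement vanish,
-- and then each minor of order 6 is, up to the block minor, minus the square of an off-diagonal
-- entry. Here it is verified by enumerating adjacency patterns on six vertices, which also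
-- identifies the classes.
--
-- Oddness of n is used in the arithmetic: class sizes 1, 2, c, 2 along a path, with 3c - 2 isolated
-- vertices, satisfy every condition for n = 4c. For odd n a path of four classes has odd sizes
-- only, and writing them as 1 + 2x turns the equation into one about halves with hardly any
-- solutions.
--
-- `det` deletes columns of a matrix over `Fin`, while the argument reorders vertices and repeats
-- them. Determinants are therefore rebuilt over lists of labels, and the two versions are compared
-- through integer values of polynomials.

private variable
  I J : Set

-- Sizes of the classes of a blow-up of P₅

module Sizes where

  open import Data.Nat using (_+_; _*_)

  odd⇒1+2* : ∀ n → ¬ 2 ∣ n → ∃ λ k → n ≡ 1 + 2 * k
  odd⇒1+2* zero          odd = contradiction (divides 0 refl) odd
  odd⇒1+2* (suc zero)    odd = 0 , refl
  odd⇒1+2* (suc (suc n)) odd =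
    let k , e = odd⇒1+2* n (λ { (divides q e) → odd (divides (suc q) (cong (λ z → suc (suc z)) e)) })
    in suc k , trans (cong (λ z → suc (suc z)) e) (lem k)
    where
    lem : ∀ k → 2 + (1 + 2 * k) ≡ 1 + 2 * (1 + k)
    lem = ℕ-Ring.solve-∀

  -- Strict inequalities below are proved by exhibiting the gap: one side is the other plus `suc` of
  -- a polynomial with natural coefficients, an identity for the ring solver.
  m≢m+1+n : ∀ {a b} n → a ≡ b → b ≢ a + suc n
  m≢m+1+n {a} n refl e = ℕₚ.m≢1+m+n a (trans e (ℕₚ.+-suc a n))

  -- ab + bc + cd = abcd + 2 reads (ab − 1)(cd − 1) = bc − 1; this is its half for a = 1 + 2x, …, d = 1 + 2w.
  half-equation : ∀ x y z w → y + z + 2 * (y * z) ≡ 2 * ((x + y + 2 * (x * y)) * (z + w + 2 * (z * w))) →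
    (y ≡ 0) × (z ≡ 0) × (x ≡ 0 ⊎ w ≡ 0)
  half-equation zero    zero    zero    w       e = refl , refl , inj₁ refl
  half-equation (suc x) zero    zero    zero    e = refl , refl , inj₂ refl
  half-equation (suc x) zero    zero    (suc w) e = contradiction (trans e (lem x w)) λ ()
    where
    lem : ∀ x w → 2 * ((suc x + 0 + 2 * (suc x * 0)) * (0 + suc w + 2 * (0 * suc w))) ≡ suc (2 * (x + w + x * w) + 1)
    lem = ℕ-Ring.solve-∀
  half-equation x       (suc y) zero    zero    e = contradiction (trans e (lem x y)) λ ()
    where
    lem : ∀ x y → 2 * ((x + suc y + 2 * (x * suc y)) * (0 + 0 + 2 * (0 * 0))) ≡ 0
    lem = ℕ-Ring.solve-∀
  half-equation x       (suc y) zero    (suc w) e = ⊥-elim (m≢m+1+n (2 * (x + w + x * w + y * w + 2 * (x * (w + y + y * w)) + 2 * x) + y) e (lem x y w))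
    where
    lem : ∀ x y w → 2 * ((x + suc y + 2 * (x * suc y)) * (0 + suc w + 2 * (0 * suc w))) ≡
          suc y + 0 + 2 * (suc y * 0) + suc (2 * (x + w + x * w + y * w + 2 * (x * (w + y + y * w)) + 2 * x) + y)
    lem = ℕ-Ring.solve-∀
  half-equation zero    zero    (suc z) w       e = contradiction e λ ()
  half-equation (suc x) zero    (suc z) w       e = ⊥-elim (m≢m+1+n (2 * (x + w + x * w + x * z + 2 * (w * (x + z + x * z)) + 2 * w) + z) e (lem x z w))
    where
    lem : ∀ x z w → 2 * ((suc x + 0 + 2 * (suc x * 0)) * (suc z + w + 2 * (suc z * w))) ≡
          0 + suc z + 2 * (0 * suc z) + suc (2 * (x + w + x * w + x * z + 2 * (w * (x + z + x * z)) + 2 * w) + z)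
    lem = ℕ-Ring.solve-∀
  -- With x = w = 0 the right side shrinks to twice the product of the two middle arguments, so here
  -- the left side is the larger one.
  half-equation zero    (suc y) (suc z) zero    e = ⊥-elim (m≢m+1+n (1 + y + z) (sym e) (lem y z))
    where
    lem : ∀ y z → suc y + suc z + 2 * (suc y * suc z) ≡
          2 * ((0 + suc y + 2 * (0 * suc y)) * (suc z + 0 + 2 * (suc z * 0))) + suc (1 + y + z)
    lem = ℕ-Ring.solve-∀
  half-equation (suc x) (suc y) (suc z) w       e = ⊥-elim (m≢m+1+n _ e (lem x y z w))
    where
    lem : ∀ x y z w → 2 * ((suc x + suc y + 2 * (suc x * suc y)) * (suc z + w + 2 * (suc z * w))) ≡
          suc y + suc z + 2 * (suc y * suc z) + suc (3 + 3 * y + 5 * z + 4 * (y * z) + 2 * (x * (3 + 2 * y) * suc z)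
               + 2 * ((suc x + suc y + 2 * (suc x * suc y)) * (w + 2 * (suc z * w))))
    lem = ℕ-Ring.solve-∀
  half-equation zero    (suc y) (suc z) (suc w) e = ⊥-elim (m≢m+1+n _ e (lem y z w))
    where
    lem : ∀ y z w → 2 * ((0 + suc y + 2 * (0 * suc y)) * (suc z + suc w + 2 * (suc z * suc w))) ≡
          suc y + suc z + 2 * (suc y * suc z) + suc (3 + 5 * y + 3 * z + 4 * (y * z) + 2 * (suc y * (w * (3 + 2 * z))))
    lem = ℕ-Ring.solve-∀

  odd-path-sizes : ∀ a b c d → ¬ 2 ∣ a * b * c * d → a * b + b * c + c * d ≡ a * b * c * d + 2 →
    (b ≡ 1) × (c ≡ 1) × (a ≡ 1 ⊎ d ≡ 1)
  odd-path-sizes a b c d odd e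
    with odd⇒1+2* a (λ h → odd (∣m⇒∣m*n d (∣m⇒∣m*n c (∣m⇒∣m*n b h))))
       | odd⇒1+2* b (λ h → odd (∣m⇒∣m*n d (∣m⇒∣m*n c (∣n⇒∣m*n a h))))
       | odd⇒1+2* c (λ h → odd (∣m⇒∣m*n d (∣n⇒∣m*n (a * b) h)))
       | odd⇒1+2* d (λ h → odd (∣n⇒∣m*n (a * b * c) h))
  ... | x , refl | y , refl | z , refl | w , refl =
    let y≡0 , z≡0 , x≡0⊎w≡0 = half-equation x y z w half
    in cong (λ k → 1 + 2 * k) y≡0 , cong (λ k → 1 + 2 * k) z≡0 , one x≡0⊎w≡0
    where
    one : x ≡ 0 ⊎ w ≡ 0 → 1 + 2 * x ≡ 1 ⊎ 1 + 2 * w ≡ 1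
    one (inj₁ e) = inj₁ (cong (λ k → 1 + 2 * k) e)
    one (inj₂ e) = inj₂ (cong (λ k → 1 + 2 * k) e)
    -- This is abcd + 2 + (bc - 1) = ab + bc + cd + (ab - 1)(cd - 1), written without subtraction.
    lem : ∀ x y z w → let a = 1 + 2 * x; b = 1 + 2 * y; c = 1 + 2 * z; d = 1 + 2 * w in
      a * b * c * d + 2 + 2 * (y + z + 2 * (y * z)) ≡
      a * b + b * c + c * d + 2 * (2 * ((x + y + 2 * (x * y)) * (z + w + 2 * (z * w))))
    lem = ℕ-Ring.solve-∀
    half : y + z + 2 * (y * z) ≡ 2 * ((x + y + 2 * (x * y)) * (z + w + 2 * (z * w)))
    half = ℕₚ.*-cancelˡ-≡ _ _ 2 (ℕₚ.+-cancelˡ-≡ (a * b * c * d + 2) _ _ (trans (lem x y z w) (cong (_+ 2 * (2 * ((x + y + 2 * (x * y)) * (z + w + 2 * (z * w))))) e)))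

  -- For u, v ≥ 1 the product side exceeds u + v by (u - 1)(v - 1) + 1. Here u and v are the edge
  -- numbers of two complete bipartite components.
  no-two-bicliques : ∀ x y → suc x + suc y ≢ suc x * suc y + 2
  no-two-bicliques x y e = m≢m+1+n (x * y) e (lem x y)
    where
    lem : ∀ x y → suc x * suc y + 2 ≡ suc x + suc y + suc (x * y)
    lem = ℕ-Ring.solve-∀

  -- The right side is always larger: in the shifted variables the difference has nonnegative
  -- coefficients and constant term 1.
  no-five-path : ∀ a b c d e → let A = suc a; B = suc b; C = suc c; D = suc d; E = suc e in
    A * B + B * C + C * D + D * E ≢ B * D * (A * C + C * E + A * E) + 2
  no-five-path a b c d e eq = m≢m+1+n _ eq (lem a b c d e)
    where
    lem : ∀ a b c d e → let A = suc a; B = suc b; C = suc c; D = suc d; E = suc e in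
      B * D * (A * C + C * E + A * E) + 2 ≡
      A * B + B * C + C * D + D * E +
      suc (a + e + a * c + c * e + a * e + b * (1 + a + c + 2 * e + a * c + c * e + a * e)
           + d * (1 + e + c + 2 * a + a * c + c * e + a * e) + b * d * (A * C + C * E + A * E))
    lem = ℕ-Ring.solve-∀

  data PathSizes (n : ℕ) : (a b c d i : ℕ) → Set where
    1-1-1-n : PathSizes n 1 1 1 n 0
    n-1-1-1 : PathSizes n n 1 1 1 0

  -- The first two equations do not see isolated vertices; the order of the graph excludes them.
  path-sizes : ∀ n a b c d i → ¬ 2 ∣ n →
    a * b + b * c + c * d ≡ n + 2 → a * b * c * d ≡ n → a + b + c + d + i ≡ n + 3 → PathSizes n a b c d i
  path-sizes _ a b c d i odd edges refl total with odd-path-sizes a b c d odd edges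
  ... | refl , refl , inj₁ refl = subst₂ (λ n → PathSizes n 1 1 1 d) (sym (lem d)) (sym i≡0) 1-1-1-n
    where
    lem : ∀ d → 1 * 1 * 1 * d ≡ d
    lem = ℕ-Ring.solve-∀
    lem′ : ∀ d → 1 * 1 * 1 * d + 3 ≡ 1 + 1 + 1 + d + 0
    lem′ = ℕ-Ring.solve-∀
    i≡0 : i ≡ 0
    i≡0 = ℕₚ.+-cancelˡ-≡ (1 + 1 + 1 + d) i 0 (trans total (lem′ d))
  ... | refl , refl , inj₂ refl = subst₂ (λ n → PathSizes n a 1 1 1) (sym (lem a)) (sym i≡0) n-1-1-1
    where
    lem : ∀ a → a * 1 * 1 * 1 ≡ a
    lem = ℕ-Ring.solve-∀
    lem′ : ∀ a → a * 1 * 1 * 1 + 3 ≡ a + 1 + 1 + 1 + 0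
    lem′ = ℕ-Ring.solve-∀
    i≡0 : i ≡ 0
    i≡0 = ℕₚ.+-cancelˡ-≡ (a + 1 + 1 + 1) i 0 (trans total (lem′ a))

  data DoubleStarSizes (n : ℕ) : (a b c d e i : ℕ) → Set where
    first-empty : ∀ {b c d e i} → PathSizes n b c d e i → DoubleStarSizes n 0 b c d e i
    last-empty  : ∀ {a b c d i} → PathSizes n a b c d i → DoubleStarSizes n a b c d 0 i

  -- An empty end class leaves a path of four classes. Otherwise b = 0 or d = 0 would make n = 0, c
  -- = 0 leaves two bicliques, and with five nonempty classes the sum of order 4 is too large for
  -- the number of edges.
  double-star-sizes : ∀ n a b c d e i → ¬ 2 ∣ n →
    a * b + b * c + c * d + d * e ≡ n + 2 → b * d * (a * c + c * e + a * e) ≡ n → a + b + c + d + e + i ≡ n + 3 →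
    DoubleStarSizes n a b c d e i
  double-star-sizes n zero b c d e i odd edges minors total =
    first-empty (path-sizes n b c d e i odd edges (trans (lem b c d e) minors) total)
    where
    lem : ∀ b c d e → b * c * d * e ≡ b * d * (0 * c + c * e + 0 * e)
    lem = ℕ-Ring.solve-∀
  double-star-sizes n a@(suc _) b c d zero i odd edges minors total =
    last-empty (path-sizes n a b c d i odd (trans (lem₁ (a * b + b * c + c * d) d) edges) (trans (lem₂ a b c d) minors)
                                           (trans (cong (_+ i) (sym (ℕₚ.+-identityʳ _))) total))
    where
    lem₁ : ∀ x d → x ≡ x + d * 0
    lem₁ = ℕ-Ring.solve-∀
    lem₂ : ∀ a b c d → a * b * c * d ≡ b * d * (a * c + c * 0 + a * 0)
    lem₂ = ℕ-Ring.solve-∀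
  double-star-sizes n (suc a) zero c d (suc e) i odd edges refl total = contradiction (divides 0 refl) odd
  double-star-sizes n (suc a) (suc b) c zero (suc e) i odd edges refl total =
    contradiction (divides 0 (cong (_* (suc a * c + c * suc e + suc a * suc e)) (ℕₚ.*-zeroʳ b))) odd
  double-star-sizes n (suc a) (suc b) zero (suc d) (suc e) i odd edges refl total =
    ⊥-elim (no-two-bicliques (b + a * suc b) (e + d * suc e) (trans (lem₁ a b d e) (trans edges (lem₂ a b d e))))
    where
    lem₁ : ∀ a b d e → suc a * suc b + suc d * suc e ≡ suc a * suc b + suc b * 0 + 0 * suc d + suc d * suc e
    lem₁ = ℕ-Ring.solve-∀
    lem₂ : ∀ a b d e → suc b * suc d * (suc a * 0 + 0 * suc e + suc a * suc e) + 2 ≡ suc a * suc b * (suc d * suc e) + 2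
    lem₂ = ℕ-Ring.solve-∀
  double-star-sizes n (suc a) (suc b) (suc c) (suc d) (suc e) i odd edges refl total = ⊥-elim (no-five-path a b c d e edges)

open Sizes
open import Data.Integer using (-_; _+_; _-_; _*_; _≤_)

-- Determinants as iterated contractions

Form : Set → Set
Form I = List I → ℤ

-- The interior product of a form with a covector, i.e. Laplace expansion along one row.
contract : (I → ℤ) → Form I → Form I
contract u F []       = 0ℤ
contract u F (c ∷ cs) = u c * F cs - contract u (F ∘ (c ∷_)) cs

unit : Form I
unit []      = 1ℤ
unit (_ ∷ _) = 0ℤ

-- The determinant with these rows and the listed columns, and 0 if their numbers differ. Labels are
-- arbitrary and may repeat, so reordering and repeating vertices become operations on lists.
wedge : List (I → ℤ) → Form I
wedge []       = unit
wedge (u ∷ us) = contract u (wedge us)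

contract-cong : ∀ {u v : I → ℤ} {F G : Form I} cs → All (λ c → u c ≡ v c) cs → F ≗ G → contract u F cs ≡ contract v G cs
contract-cong []       []       e = refl
contract-cong (c ∷ cs) (p ∷ ps) e = cong₂ _-_ (cong₂ _*_ p (e cs)) (contract-cong cs ps (e ∘ (c ∷_)))

contract-congʳ : ∀ (u : I → ℤ) {F G : Form I} → F ≗ G → contract u F ≗ contract u G
contract-congʳ u e cs = contract-cong cs (All.universal (λ _ → refl) cs) e

contract-neg : ∀ (u : I → ℤ) (F : Form I) cs → contract u (-_ ∘ F) cs ≡ - contract u F cs
contract-neg u F []       = refl
contract-neg u F (c ∷ cs) = trans (cong (λ z → u c * - F cs - z) (contract-neg u (F ∘ (c ∷_)) cs)) (lem (u c) (F cs) _)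
  where
  lem : ∀ x y z → x * - y - - z ≡ - (x * y - z)
  lem = solve-∀

contract-affine : ∀ (u : I → ℤ) k (F G : Form I) cs →
  contract u (λ ds → k * F ds - G ds) cs ≡ k * contract u F cs - contract u G cs
contract-affine u k F G []       = lem k
  where
  lem : ∀ k → 0ℤ ≡ k * 0ℤ - 0ℤ
  lem = solve-∀
contract-affine u k F G (c ∷ cs) =
  trans (cong (λ z → u c * (k * F cs - G cs) - z) (contract-affine u k (F ∘ (c ∷_)) (G ∘ (c ∷_)) cs))
        (lem (u c) k (F cs) (G cs) _ _)
  where
  lem : ∀ x k f g y z → x * (k * f - g) - (k * y - z) ≡ k * (x * f - y) - (x * g - z)
  lem = solve-∀

-- The row exchange rule, valid for every form; column exchange is `contract-alternating` and
-- requires `F` to be alternating.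
contract-anticomm : ∀ (u v : I → ℤ) (F : Form I) cs → contract u (contract v F) cs ≡ - contract v (contract u F) cs
contract-anticomm u v F []       = refl
contract-anticomm u v F (c ∷ cs) = begin
  u c * contract v F cs - contract u (λ ds → v c * F ds - contract v F′ ds) cs
    ≡⟨ cong (λ z → u c * contract v F cs - z) (contract-affine u (v c) F (contract v F′) cs) ⟩
  u c * contract v F cs - (v c * contract u F cs - contract u (contract v F′) cs)
    ≡⟨ cong (λ z → u c * contract v F cs - (v c * contract u F cs - z)) (contract-anticomm u v F′ cs) ⟩
  u c * contract v F cs - (v c * contract u F cs - - contract v (contract u F′) cs)
    ≡⟨ lem (u c * contract v F cs) (v c * contract u F cs) (contract v (contract u F′) cs) ⟩
  - (v c * contract u F cs - (u c * contract v F cs - contract v (contract u F′) cs))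
    ≡⟨ cong (λ z → - (v c * contract u F cs - z)) (contract-affine v (u c) F (contract u F′) cs) ⟨
  - (v c * contract u F cs - contract v (λ ds → u c * F ds - contract u F′ ds) cs) ∎
  where
  open ≡-Reasoning
  F′ = F ∘ (c ∷_)
  lem : ∀ x y z → x - (y - - z) ≡ - (y - (x - z))
  lem = solve-∀

Alternating : Form I → Set
Alternating F = ∀ xs a b ys → F (xs ++ a ∷ b ∷ ys) ≡ - F (xs ++ b ∷ a ∷ ys)

contract-alternating : ∀ (u : I → ℤ) {F : Form I} → Alternating F → Alternating (contract u F)
contract-alternating u {F} alt [] a b ys =
  trans (cong (λ z → u a * F (b ∷ ys) - (u b * F (a ∷ ys) - z))
              (trans (contract-congʳ u (alt [] a b) ys) (contract-neg u _ ys)))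
        (lem (u a * F (b ∷ ys)) (u b * F (a ∷ ys)) _)
  where
  lem : ∀ x y z → x - (y - - z) ≡ - (y - (x - z))
  lem = solve-∀
contract-alternating u {F} alt (x ∷ xs) a b ys =
  trans (cong₂ (λ y z → u x * y - z) (alt xs a b ys) (contract-alternating u (λ zs → alt (x ∷ zs)) xs a b ys))
        (lem (u x) _ _)
  where
  lem : ∀ x y z → x * - y - - z ≡ - (x * y - z)
  lem = solve-∀

wedge-alternating : ∀ (us : List (I → ℤ)) → Alternating (wedge us)
wedge-alternating []       []       a b ys = refl
wedge-alternating []       (x ∷ xs) a b ys = refl
wedge-alternating (u ∷ us) = contract-alternating u (wedge-alternating us)

wedge-swap : ∀ us (u v : I → ℤ) vs cs → wedge (us ++ u ∷ v ∷ vs) cs ≡ - wedge (us ++ v ∷ u ∷ vs) cs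
wedge-swap []       u v vs cs = contract-anticomm u v (wedge vs) cs
wedge-swap (w ∷ us) u v vs cs = trans (contract-congʳ w (wedge-swap us u v vs) cs) (contract-neg w _ cs)

-- Each entry pairs a row with the column met by it on the diagonal.
minor : List ((I → ℤ) × I) → ℤ
minor ps = wedge (map proj₁ ps) (map proj₂ ps)

minor-swap : ∀ ps (p q : (I → ℤ) × I) rs → minor (ps ++ p ∷ q ∷ rs) ≡ minor (ps ++ q ∷ p ∷ rs)
minor-swap ps p q rs = begin
  wedge (map proj₁ (ps ++ p ∷ q ∷ rs)) (map proj₂ (ps ++ p ∷ q ∷ rs))
    ≡⟨ cong₂ wedge (Listₚ.map-++ proj₁ ps _) (Listₚ.map-++ proj₂ ps _) ⟩
  wedge (us ++ u ∷ v ∷ vs) (cs ++ c ∷ d ∷ ds)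
    ≡⟨ wedge-swap us u v vs _ ⟩
  - wedge (us ++ v ∷ u ∷ vs) (cs ++ c ∷ d ∷ ds)
    ≡⟨ cong -_ (wedge-alternating (us ++ v ∷ u ∷ vs) cs c d ds) ⟩
  - - wedge (us ++ v ∷ u ∷ vs) (cs ++ d ∷ c ∷ ds)
    ≡⟨ ℤₚ.neg-involutive _ ⟩
  wedge (us ++ v ∷ u ∷ vs) (cs ++ d ∷ c ∷ ds)
    ≡⟨ cong₂ wedge (Listₚ.map-++ proj₁ ps _) (Listₚ.map-++ proj₂ ps _) ⟨
  minor (ps ++ q ∷ p ∷ rs) ∎
  where
  open ≡-Reasoning
  us = map proj₁ ps
  vs = map proj₁ rs
  cs = map proj₂ ps
  ds = map proj₂ rs
  u = proj₁ p
  v = proj₁ q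
  c = proj₂ p
  d = proj₂ q

-- A determinant cannot be peeled at its first entry, so the common head in `prep` moves into the
-- prefix `os`, behind which `minor-swap` still applies.
minor-++-↭ : ∀ os {ps qs : List ((I → ℤ) × I)} → ps ↭ qs → minor (os ++ ps) ≡ minor (os ++ qs)
minor-++-↭ os Perm.refl = refl
minor-++-↭ os {p ∷ ps} {_ ∷ qs} (prep p ps↭qs) =
  trans (cong minor (sym (Listₚ.++-assoc os (p ∷ []) ps)))
  (trans (minor-++-↭ (os ++ p ∷ []) ps↭qs) (cong minor (Listₚ.++-assoc os (p ∷ []) qs)))
minor-++-↭ os {_ ∷ _ ∷ ps} {_ ∷ _ ∷ qs} (swap p q ps↭qs) =
  trans (minor-swap os p q ps)
  (trans (cong minor (sym (Listₚ.++-assoc os (q ∷ p ∷ []) ps)))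
  (trans (minor-++-↭ (os ++ q ∷ p ∷ []) ps↭qs) (cong minor (Listₚ.++-assoc os (q ∷ p ∷ []) qs))))
minor-++-↭ os (Perm.trans p q) = trans (minor-++-↭ os p) (minor-++-↭ os q)

minor-↭ : ∀ {ps qs : List ((I → ℤ) × I)} → ps ↭ qs → minor ps ≡ minor qs
minor-↭ = minor-++-↭ []

x≡-x⇒x≡0 : ∀ x → x ≡ - x → x ≡ 0ℤ
x≡-x⇒x≡0 (+ zero)  _  = refl
x≡-x⇒x≡0 (+ suc _) ()
x≡-x⇒x≡0 ℤ.-[1+ _ ] ()

principal : (I → I → ℤ) → List I → ℤ
principal M is = minor (map (λ i → M i , i) is)

principal-↭ : ∀ (M : I → I → ℤ) {is js} → is ↭ js → principal M is ≡ principal M js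
principal-↭ M p = minor-↭ (Permₚ.map⁺ _ p)

-- Equal rows make the value its own negative. This is why a principal minor sees at most one vertex
-- from each class of a blow-up.
principal-repeat : ∀ (M : I → I → ℤ) i is → principal M (i ∷ i ∷ is) ≡ 0ℤ
principal-repeat M i is = x≡-x⇒x≡0 _ (contract-anticomm (M i) (M i) (wedge (map proj₁ ps)) (i ∷ i ∷ map proj₂ ps))
  where ps = map (λ i → M i , i) is

contract-map : ∀ (f : J → I) (u : I → ℤ) F cs → contract u F (map f cs) ≡ contract (u ∘ f) (F ∘ map f) cs
contract-map f u F []       = refl
contract-map f u F (c ∷ cs) = cong (λ z → u (f c) * F (map f cs) - z) (contract-map f u (F ∘ (f c ∷_)) cs)

wedge-map : ∀ (f : J → I) (M : I → I → ℤ) (N : J → J → ℤ) → (∀ i j → N i j ≡ M (f i) (f j)) →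
  ∀ rs cs → wedge (map M (map f rs)) (map f cs) ≡ wedge (map N rs) cs
wedge-map f M N e []       []       = refl
wedge-map f M N e []       (_ ∷ _)  = refl
wedge-map f M N e (r ∷ rs) cs       =
  trans (contract-map f (M (f r)) _ cs)
        (contract-cong cs (All.universal (λ c → sym (e r c)) cs) (wedge-map f M N e rs))

principal-wedge : ∀ (M : I → I → ℤ) is → principal M is ≡ wedge (map M is) is
principal-wedge M is = cong₂ wedge (sym (Listₚ.map-∘ is)) (trans (sym (Listₚ.map-∘ is)) (Listₚ.map-id is))

principal-map : ∀ (f : J → I) (M : I → I → ℤ) (N : J → J → ℤ) → (∀ i j → N i j ≡ M (f i) (f j)) →
  ∀ is → principal M (map f is) ≡ principal N is
principal-map f M N e is =
  trans (principal-wedge M (map f is)) (trans (wedge-map f M N e is is) (sym (principal-wedge N is)))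

-- Sums of principal minors

-- minorSum M k S L is the sum of the principal minors of M on S ∪ K, for K ⊆ L with |K| = k.
minorSum : (I → I → ℤ) → ℕ → List I → List I → ℤ
minorSum M zero    S L       = principal M S
minorSum M (suc k) S []      = 0ℤ
minorSum M (suc k) S (r ∷ L) = minorSum M (suc k) S L + minorSum M k (r ∷ S) L

minorSum-↭ˡ : ∀ (M : I → I → ℤ) k {S S′} L → S ↭ S′ → minorSum M k S L ≡ minorSum M k S′ L
minorSum-↭ˡ M zero    L       p = principal-↭ M p
minorSum-↭ˡ M (suc k) []      p = refl
minorSum-↭ˡ M (suc k) (r ∷ L) p = cong₂ _+_ (minorSum-↭ˡ M (suc k) L p) (minorSum-↭ˡ M k L (prep r p))

minorSum-↭ʳ : ∀ (M : I → I → ℤ) k S {L L′} → L ↭ L′ → minorSum M k S L ≡ minorSum M k S L′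
minorSum-↭ʳ M zero    S p          = refl
minorSum-↭ʳ M (suc k) S Perm.refl  = refl
minorSum-↭ʳ M (suc k) S (prep x p) = cong₂ _+_ (minorSum-↭ʳ M (suc k) S p) (minorSum-↭ʳ M k (x ∷ S) p)
minorSum-↭ʳ M (suc zero) S {_} {_ ∷ _ ∷ L′} (swap x y p) =
  trans (cong (λ z → z + principal M (y ∷ S) + principal M (x ∷ S)) (minorSum-↭ʳ M 1 S p))
        (lem (minorSum M 1 S L′) (principal M (y ∷ S)) (principal M (x ∷ S)))
  where
  lem : ∀ a b c → a + b + c ≡ a + c + b
  lem = solve-∀
minorSum-↭ʳ M (suc (suc k)) S {_} {_ ∷ _ ∷ L′} (swap x y p) =
  trans (cong₂ _+_ (cong₂ _+_ (minorSum-↭ʳ M (suc (suc k)) S p) (minorSum-↭ʳ M (suc k) (y ∷ S) p))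
                   (cong₂ _+_ (minorSum-↭ʳ M (suc k) (x ∷ S) p)
                              (trans (minorSum-↭ʳ M k (y ∷ x ∷ S) p) (minorSum-↭ˡ M k L′ (swap y x ↭-refl)))))
        (lem (minorSum M (suc (suc k)) S L′) (minorSum M (suc k) (y ∷ S) L′)
             (minorSum M (suc k) (x ∷ S) L′) (minorSum M k (x ∷ y ∷ S) L′))
  where
  lem : ∀ a b c d → a + b + (c + d) ≡ a + c + (b + d)
  lem = solve-∀
minorSum-↭ʳ M (suc k) S (Perm.trans p q) = trans (minorSum-↭ʳ M (suc k) S p) (minorSum-↭ʳ M (suc k) S q)

minorSum-repeat : ∀ (M : I → I → ℤ) k i S L → minorSum M k (i ∷ i ∷ S) L ≡ 0ℤ
minorSum-repeat M zero    i S L       = principal-repeat M i S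
minorSum-repeat M (suc k) i S []      = refl
minorSum-repeat M (suc k) i S (r ∷ L) =
  cong₂ _+_ (minorSum-repeat M (suc k) i S L)
            (trans (minorSum-↭ˡ M k L (↭-sym (Permₚ.shift r (i ∷ i ∷ []) S))) (minorSum-repeat M k i (r ∷ S) L))

minorSum-map : ∀ (f : J → I) (M : I → I → ℤ) (N : J → J → ℤ) → (∀ i j → N i j ≡ M (f i) (f j)) →
  ∀ k S L → minorSum M k (map f S) (map f L) ≡ minorSum N k S L
minorSum-map f M N e zero    S L       = principal-map f M N e S
minorSum-map f M N e (suc k) S []      = refl
minorSum-map f M N e (suc k) S (r ∷ L) = cong₂ _+_ (minorSum-map f M N e (suc k) S L) (minorSum-map f M N e k (r ∷ S) L)

minorSum-replicate-used : ∀ (M : I → I → ℤ) k n t S L → minorSum M k (t ∷ S) (replicate n t ++ L) ≡ minorSum M k (t ∷ S) L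
minorSum-replicate-used M zero    n       t S L = refl
minorSum-replicate-used M (suc k) zero    t S L = refl
minorSum-replicate-used M (suc k) (suc n) t S L =
  trans (cong₂ _+_ (minorSum-replicate-used M (suc k) n t S L) (minorSum-repeat M k t S _)) (ℤₚ.+-identityʳ _)

minorSum-replicate : ∀ (M : I → I → ℤ) k n t S L →
  minorSum M (suc k) S (replicate n t ++ L) ≡ minorSum M (suc k) S L + + n * minorSum M k (t ∷ S) L
minorSum-replicate M k zero    t S L = lem _ (minorSum M k (t ∷ S) L)
  where
  lem : ∀ a b → a ≡ a + 0ℤ * b
  lem = solve-∀
minorSum-replicate M k (suc n) t S L =
  trans (cong₂ _+_ (minorSum-replicate M k n t S L) (minorSum-replicate-used M k n t S L))
        (lem (minorSum M (suc k) S L) (+ n) (minorSum M k (t ∷ S) L))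
  where
  lem : ∀ a n b → a + n * b + b ≡ a + (1ℤ + n) * b
  lem = solve-∀

clones : List (ℕ × I) → List I
clones []             = []
clones ((n , t) ∷ ts) = replicate n t ++ clones ts

-- The sum over all choices of k entries of the list: the product of their multiplicities times the
-- principal minor of the quotient matrix on their labels together with `S`.
weightedMinorSum : (I → I → ℤ) → ℕ → List I → List (ℕ × I) → ℤ
weightedMinorSum M zero    S ts             = principal M S
weightedMinorSum M (suc k) S []             = 0ℤ
weightedMinorSum M (suc k) S ((n , t) ∷ ts) = weightedMinorSum M (suc k) S ts + + n * weightedMinorSum M k (t ∷ S) ts

minorSum-clones : ∀ (M : I → I → ℤ) k S ts → minorSum M k S (clones ts) ≡ weightedMinorSum M k S ts
minorSum-clones M zero    S ts             = refl
minorSum-clones M (suc k) S []             = refl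
minorSum-clones M (suc k) S ((n , t) ∷ ts) =
  trans (minorSum-replicate M k n t S (clones ts))
        (cong₂ (λ a b → a + + n * b) (minorSum-clones M (suc k) S ts) (minorSum-clones M k (t ∷ S) ts))

-- Evaluation of polynomials and of det

eval : ℤ → Poly → ℤ
eval x []      = 0ℤ
eval x (a ∷ p) = a + x * eval x p

eval-+ₚ : ∀ x p q → eval x (p +ₚ q) ≡ eval x p + eval x q
eval-+ₚ x []      q       = sym (ℤₚ.+-identityˡ _)
eval-+ₚ x (a ∷ p) []      = sym (ℤₚ.+-identityʳ _)
eval-+ₚ x (a ∷ p) (b ∷ q) = trans (cong (λ z → a + b + x * z) (eval-+ₚ x p q)) (lem a b x _ _)
  where
  lem : ∀ a b x y z → a + b + x * (y + z) ≡ a + x * y + (b + x * z)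
  lem = solve-∀

eval-scaleₚ : ∀ x c p → eval x (scaleₚ c p) ≡ c * eval x p
eval-scaleₚ x c []      = sym (ℤₚ.*-zeroʳ c)
eval-scaleₚ x c (a ∷ p) = trans (cong (λ z → c * a + x * z) (eval-scaleₚ x c p)) (lem c a x _)
  where
  lem : ∀ c a x y → c * a + x * (c * y) ≡ c * (a + x * y)
  lem = solve-∀

eval-*ₚ : ∀ x p q → eval x (p *ₚ q) ≡ eval x p * eval x q
eval-*ₚ x []      q = refl
eval-*ₚ x (a ∷ p) q = begin
  eval x (scaleₚ a q +ₚ (0ℤ ∷ (p *ₚ q)))        ≡⟨ eval-+ₚ x (scaleₚ a q) _ ⟩
  eval x (scaleₚ a q) + (0ℤ + x * eval x (p *ₚ q)) ≡⟨ cong₂ (λ y z → y + (0ℤ + x * z)) (eval-scaleₚ x a q) (eval-*ₚ x p q) ⟩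
  a * eval x q + (0ℤ + x * (eval x p * eval x q)) ≡⟨ lem a x (eval x p) (eval x q) ⟩
  (a + x * eval x p) * eval x q                  ∎
  where
  open ≡-Reasoning
  lem : ∀ a x y z → a * z + (0ℤ + x * (y * z)) ≡ (a + x * y) * z
  lem = solve-∀

eval-++-zeros : ∀ x p k → eval x (p ++ replicate k 0ℤ) ≡ eval x p
eval-++-zeros x []      zero    = refl
eval-++-zeros x []      (suc k) = trans (cong (λ z → 0ℤ + x * z) (eval-++-zeros x [] k)) (lem x)
  where
  lem : ∀ x → 0ℤ + x * 0ℤ ≡ 0ℤ
  lem = solve-∀
eval-++-zeros x (a ∷ p) k       = cong (λ z → a + x * z) (eval-++-zeros x p k)

dropZeros-++ : ∀ p → ∃ λ k → replicate k 0ℤ ++ dropZeros p ≡ p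
dropZeros-++ []      = 0 , refl
dropZeros-++ (a ∷ p) with a ℤ.≟ + 0
... | yes refl = let k , e = dropZeros-++ p in suc k , cong (0ℤ ∷_) e
... | no _     = 0 , refl

reverse-replicate : ∀ {A : Set} k (a : A) → reverse (replicate k a) ≡ replicate k a
reverse-replicate zero    a = refl
reverse-replicate (suc k) a =
  trans (Listₚ.unfold-reverse a (replicate k a)) (trans (cong (_++ a ∷ []) (reverse-replicate k a)) (snoc k))
  where
  snoc : ∀ k → replicate k a ++ a ∷ [] ≡ a ∷ replicate k a
  snoc zero    = refl
  snoc (suc k) = cong (a ∷_) (snoc k)

eval-normalise : ∀ x p → eval x (normalise p) ≡ eval x p
eval-normalise x p = let k , e = dropZeros-++ (reverse p) in begin
  eval x (reverse (dropZeros (reverse p)))                            ≡⟨ eval-++-zeros x (reverse (dropZeros (reverse p))) k ⟨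
  eval x (reverse (dropZeros (reverse p)) ++ replicate k 0ℤ)           ≡⟨ cong (λ z → eval x (reverse (dropZeros (reverse p)) ++ z)) (reverse-replicate k 0ℤ) ⟨
  eval x (reverse (dropZeros (reverse p)) ++ reverse (replicate k 0ℤ)) ≡⟨ cong (eval x) (Listₚ.reverse-++ (replicate k 0ℤ) _) ⟨
  eval x (reverse (replicate k 0ℤ ++ dropZeros (reverse p)))           ≡⟨ cong (eval x ∘ reverse) e ⟩
  eval x (reverse (reverse p))                                        ≡⟨ cong (eval x) (Listₚ.reverse-involutive p) ⟩
  eval x p                                                            ∎
  where open ≡-Reasoning

∑ : ∀ {n} → (Fin n → ℤ) → ℤ
∑ {zero}  f = 0ℤ
∑ {suc n} f = f zero + ∑ (f ∘ suc)

∑-cong : ∀ {n} {f g : Fin n → ℤ} → f ≗ g → ∑ f ≡ ∑ g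
∑-cong {zero}  e = refl
∑-cong {suc n} e = cong₂ _+_ (e zero) (∑-cong (e ∘ suc))

∑-neg : ∀ {n} (f : Fin n → ℤ) → ∑ (-_ ∘ f) ≡ - ∑ f
∑-neg {zero}  f = refl
∑-neg {suc n} f = trans (cong (λ z → - f zero + z) (∑-neg (f ∘ suc))) (sym (ℤₚ.neg-distrib-+ (f zero) _))

eval-sumFin : ∀ x {n} (f : Fin n → Poly) → eval x (sumFin f) ≡ ∑ (eval x ∘ f)
eval-sumFin x {zero}  f = refl
eval-sumFin x {suc n} f = trans (eval-+ₚ x (f zero) _) (cong (λ z → eval x (f zero) + z) (eval-sumFin x (f ∘ suc)))

sign : ℕ → ℤ
sign zero    = 1ℤ
sign (suc k) = - sign k

contract-tabulate : ∀ {n} (u : I → ℤ) F (c : Fin (suc n) → I) →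
  contract u F (tabulate c) ≡ ∑ λ j → sign (toℕ j) * (u (c j) * F (tabulate (c ∘ punchIn j)))
contract-tabulate {n = zero} u F c = lem (u (c zero) * F [])
  where
  lem : ∀ x → x - 0ℤ ≡ 1ℤ * x + 0ℤ
  lem = solve-∀
contract-tabulate {n = suc n} u F c = cong₂ _+_ (sym (ℤₚ.*-identityˡ (u (c zero) * F (tabulate (c ∘ suc))))) (begin
  - contract u (F ∘ (c zero ∷_)) (tabulate (c ∘ suc))
    ≡⟨ cong -_ (contract-tabulate u (F ∘ (c zero ∷_)) (c ∘ suc)) ⟩
  - ∑ term
    ≡⟨ ∑-neg term ⟨
  ∑ (-_ ∘ term)
    ≡⟨ ∑-cong (λ j → ℤₚ.neg-distribˡ-* (sign (toℕ j)) (u (c (suc j)) * F (c zero ∷ tabulate (c ∘ suc ∘ punchIn j)))) ⟩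
  ∑ (λ j → - sign (toℕ j) * (u (c (suc j)) * F (c zero ∷ tabulate (c ∘ suc ∘ punchIn j)))) ∎)
  where
  open ≡-Reasoning
  term : Fin (suc n) → ℤ
  term j = sign (toℕ j) * (u (c (suc j)) * F (c zero ∷ tabulate (c ∘ suc ∘ punchIn j)))

signed : ℕ → Poly → Poly
signed zero          p = p
signed (suc zero)    p = negₚ p
signed (suc (suc k)) p = signed k p

eval-signed : ∀ x k p → eval x (signed k p) ≡ sign k * eval x p
eval-signed x zero          p = sym (ℤₚ.*-identityˡ (eval x p))
eval-signed x (suc zero)    p = eval-scaleₚ x (- 1ℤ) p
eval-signed x (suc (suc k)) p = trans (eval-signed x k p) (cong (_* eval x p) (sym (ℤₚ.neg-involutive (sign k))))

-- The index is shifted by one because the first summand of `det` is split off: `s k` signs column k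
-- + 1, so `s 0` negates.
signed-unique : (s : ℕ → Poly → Poly) → (∀ p → s 0 p ≡ negₚ p) → (∀ p → s 1 p ≡ p) → (∀ k p → s (suc (suc k)) p ≡ s k p) →
  ∀ k p → s k p ≡ signed (suc k) p
signed-unique s s₀ s₁ s₂ zero          p = s₀ p
signed-unique s s₀ s₁ s₂ (suc zero)    p = s₁ p
signed-unique s s₀ s₁ s₂ (suc (suc k)) p = trans (s₂ k p) (signed-unique s s₀ s₁ s₂ k p)

Matrix : ℕ → Set
Matrix n = Fin n → Fin n → Poly

cofactor : ∀ {n} → Matrix (suc n) → Fin (suc n) → Matrix n
cofactor M j r c = M (suc r) (punchIn j c)

-- The `_` is solved by matching the unfolded `det (suc n) M` with `a +ₚ sumFin g`; this gives the
-- anonymous summands a name.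
laterTerms : ∀ n → Matrix (suc n) → Fin n → Poly
laterTerms n M = summands (M zero zero *ₚ det n (cofactor M zero)) _ (det (suc n) M) refl
  where
  summands : ∀ {n} a (g : Fin n → Poly) p → p ≡ a +ₚ sumFin g → Fin n → Poly
  summands a g p e = g

-- `det` uses a local copy of `signed` that has no name outside of it; unification recovers it here.
mutual
  localSigned : ∀ n → Matrix (suc n) → ℕ → Poly → Poly
  localSigned = _

  laterTerms-localSigned : ∀ n M j → laterTerms n M j ≡ localSigned n M (toℕ j) (M zero (suc j) *ₚ det n (cofactor M (suc j)))
  laterTerms-localSigned n M j with toℕ j | M zero (suc j) *ₚ det n (cofactor M (suc j))
  ... | k | p = refl

laterTerms-signed : ∀ n M j → laterTerms n M j ≡ signed (suc (toℕ j)) (M zero (suc j) *ₚ det n (cofactor M (suc j)))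
laterTerms-signed n M j =
  trans (laterTerms-localSigned n M j)
        (signed-unique (localSigned n M) (λ _ → refl) (λ _ → refl) (λ _ _ → refl) (toℕ j) _)

-- Rows are functions of column labels, so deleting a column changes only the labelling `c` and the
-- remaining rows stay as they are.
eval-det : ∀ x n M (u : Fin n → I → ℤ) (c : Fin n → I) → (∀ i j → eval x (M i j) ≡ u i (c j)) →
  eval x (det n M) ≡ wedge (tabulate u) (tabulate c)
eval-det x zero    M u c e = cong (λ z → 1ℤ + z) (ℤₚ.*-zeroʳ x)
eval-det x (suc n) M u c e = begin
  eval x (det (suc n) M)
    ≡⟨ eval-+ₚ x (M zero zero *ₚ det n (cofactor M zero)) _ ⟩
  eval x (M zero zero *ₚ det n (cofactor M zero)) + eval x (sumFin (laterTerms n M))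
    ≡⟨ cong₂ _+_ (trans (term zero) (sym (ℤₚ.*-identityˡ _)))
                 (trans (eval-sumFin x (laterTerms n M))
                        (∑-cong λ j → trans (cong (eval x) (laterTerms-signed n M j))
                                       (trans (eval-signed x (suc (toℕ j)) _) (cong (sign (suc (toℕ j)) *_) (term (suc j)))))) ⟩
  ∑ (λ j → sign (toℕ j) * (u zero (c j) * wedge (tabulate (u ∘ suc)) (tabulate (c ∘ punchIn j))))
    ≡⟨ contract-tabulate (u zero) (wedge (tabulate (u ∘ suc))) c ⟨
  wedge (tabulate u) (tabulate c) ∎
  where
  open ≡-Reasoning
  term : ∀ j → eval x (M zero j *ₚ det n (cofactor M j)) ≡ u zero (c j) * wedge (tabulate (u ∘ suc)) (tabulate (c ∘ punchIn j))
  term j = trans (eval-*ₚ x (M zero j) _)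
                 (cong₂ _*_ (e zero j) (eval-det x n (cofactor M j) (u ∘ suc) (c ∘ punchIn j) (λ r k → e (suc r) (punchIn j k))))

-- Coefficients of the characteristic polynomial

coeff : Poly → ℕ → ℤ
coeff []      _       = 0ℤ
coeff (a ∷ p) zero    = a
coeff (a ∷ p) (suc i) = coeff p i

coeff-+ₚ : ∀ p q i → coeff (p +ₚ q) i ≡ coeff p i + coeff q i
coeff-+ₚ []      q       i       = sym (ℤₚ.+-identityˡ _)
coeff-+ₚ (a ∷ p) []      i       = sym (ℤₚ.+-identityʳ _)
coeff-+ₚ (a ∷ p) (b ∷ q) zero    = refl
coeff-+ₚ (a ∷ p) (b ∷ q) (suc i) = coeff-+ₚ p q i

coeff-scaleₚ : ∀ c p i → coeff (scaleₚ c p) i ≡ c * coeff p i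
coeff-scaleₚ c []      i       = sym (ℤₚ.*-zeroʳ c)
coeff-scaleₚ c (a ∷ p) zero    = refl
coeff-scaleₚ c (a ∷ p) (suc i) = coeff-scaleₚ c p i

n≡[1+n]*m⇒n≡0 : ∀ n m → n ≡ suc n ℕ.* m → n ≡ 0
n≡[1+n]*m⇒n≡0 n zero    eq = trans eq (ℕₚ.*-zeroʳ n)
n≡[1+n]*m⇒n≡0 n (suc m) eq = ⊥-elim (ℕₚ.<-irrefl eq (ℕₚ.m≤m*n (suc n) (suc m)))

-- The constant term a is divisible by |a| + 1.
eval-zero⇒head-zero : ∀ a p → (∀ k → eval (+ suc k) (a ∷ p) ≡ 0ℤ) → a ≡ 0ℤ
eval-zero⇒head-zero a p e = ℤₚ.∣i∣≡0⇒i≡0 (n≡[1+n]*m⇒n≡0 ℤ.∣ a ∣ ℤ.∣ y ∣ (begin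
  ℤ.∣ a ∣             ≡⟨ cong ℤ.∣_∣ (trans (lem a (x * y)) (cong (_- x * y) (e ℤ.∣ a ∣))) ⟩
  ℤ.∣ 0ℤ - x * y ∣    ≡⟨ cong ℤ.∣_∣ (ℤₚ.+-identityˡ (- (x * y))) ⟩
  ℤ.∣ - (x * y) ∣     ≡⟨ ℤₚ.∣-i∣≡∣i∣ (x * y) ⟩
  ℤ.∣ x * y ∣         ≡⟨ ℤₚ.abs-* x y ⟩
  suc ℤ.∣ a ∣ ℕ.* ℤ.∣ y ∣ ∎))
  where
  open ≡-Reasoning
  x = + suc ℤ.∣ a ∣
  y = eval x p
  lem : ∀ a b → a ≡ a + b - b
  lem = solve-∀

-- The evaluation points are positive, so once the constant term is known to be 0 the factor x can
-- be cancelled and the tail vanishes at the same points.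
eval-zero⇒coeff-zero : ∀ p → (∀ k → eval (+ suc k) p ≡ 0ℤ) → ∀ i → coeff p i ≡ 0ℤ
eval-zero⇒coeff-zero []      e i       = refl
eval-zero⇒coeff-zero (a ∷ p) e zero    = eval-zero⇒head-zero a p e
eval-zero⇒coeff-zero (a ∷ p) e (suc i) = eval-zero⇒coeff-zero p tail-zero i
  where
  tail-zero : ∀ k → eval (+ suc k) p ≡ 0ℤ
  tail-zero k = ℤₚ.*-cancelˡ-≡ x y 0ℤ (begin
    x * y        ≡⟨ ℤₚ.+-identityˡ (x * y) ⟨
    0ℤ + x * y   ≡⟨ cong (_+ x * y) (eval-zero⇒head-zero a p e) ⟨
    a + x * y    ≡⟨ e k ⟩
    0ℤ           ≡⟨ ℤₚ.*-zeroʳ x ⟨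
    x * 0ℤ       ∎)
    where
    open ≡-Reasoning
    x = + suc k
    y = eval x p

eval-injective : ∀ p q → (∀ x → eval x p ≡ eval x q) → ∀ i → coeff p i ≡ coeff q i
eval-injective p q e i = ℤₚ.i-j≡0⇒i≡j (coeff p i) (coeff q i) (begin
  coeff p i - coeff q i            ≡⟨ cong (λ z → coeff p i + z) (trans (coeff-scaleₚ (- 1ℤ) q i) (ℤₚ.-1*i≡-i (coeff q i))) ⟨
  coeff p i + coeff (negₚ q) i     ≡⟨ coeff-+ₚ p (negₚ q) i ⟨
  coeff (p +ₚ negₚ q) i            ≡⟨ eval-zero⇒coeff-zero (p +ₚ negₚ q) (λ k → eval-diff (+ suc k)) i ⟩
  0ℤ                               ∎)
  where
  open ≡-Reasoning
  eval-diff : ∀ x → eval x (p +ₚ negₚ q) ≡ 0ℤ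
  eval-diff x = trans (eval-+ₚ x p (negₚ q)) (trans (cong₂ _+_ (e x) (trans (eval-scaleₚ x (- 1ℤ) q) (ℤₚ.-1*i≡-i _))) (ℤₚ.+-inverseʳ (eval x q)))

-- For S = [], the characteristic polynomial of -M restricted to L.
expansion : (I → I → ℤ) → List I → List I → Poly
expansion M S []      = principal M S ∷ []
expansion M S (r ∷ L) = (0ℤ ∷ expansion M S L) +ₚ expansion M (r ∷ S) L

coeff-expansion-high : ∀ (M : I → I → ℤ) S L j → length L ℕ.< j → coeff (expansion M S L) j ≡ 0ℤ
coeff-expansion-high M S []      (suc j) _       = refl
coeff-expansion-high M S (r ∷ L) (suc j) (s≤s h) =
  trans (coeff-+ₚ (0ℤ ∷ expansion M S L) (expansion M (r ∷ S) L) (suc j))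
        (cong₂ _+_ (coeff-expansion-high M S L j h) (coeff-expansion-high M (r ∷ S) L (suc j) (ℕₚ.m≤n⇒m≤1+n h)))

minorSum-high : ∀ (M : I → I → ℤ) k S L → length L ℕ.< k → minorSum M k S L ≡ 0ℤ
minorSum-high M (suc k) S []      h       = refl
minorSum-high M (suc k) S (r ∷ L) (s≤s h) =
  cong₂ _+_ (minorSum-high M (suc k) S L (ℕₚ.m≤n⇒m≤1+n h)) (minorSum-high M k (r ∷ S) L h)

-- Every vertex of `L` contributes either a factor x or its row of `M`; the coefficient of x to the
-- power j leaves out j vertices and keeps k.
coeff-expansion : ∀ (M : I → I → ℤ) S L j k → j ℕ.+ k ≡ length L → coeff (expansion M S L) j ≡ minorSum M k S L
coeff-expansion M S []      zero    zero    eq = refl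
coeff-expansion M S (r ∷ L) zero    (suc k) eq =
  trans (coeff-+ₚ (0ℤ ∷ expansion M S L) (expansion M (r ∷ S) L) zero)
        (cong₂ _+_ (sym (minorSum-high M (suc k) S L (ℕₚ.≤-reflexive (sym eq)))) (coeff-expansion M (r ∷ S) L zero k (ℕₚ.suc-injective eq)))
coeff-expansion M S (r ∷ L) (suc j) zero    eq =
  trans (coeff-+ₚ (0ℤ ∷ expansion M S L) (expansion M (r ∷ S) L) (suc j))
  (trans (cong₂ _+_ (coeff-expansion M S L j zero (ℕₚ.suc-injective eq))
                    (coeff-expansion-high M (r ∷ S) L (suc j) (ℕₚ.≤-reflexive (trans (sym eq) (ℕₚ.+-identityʳ (suc j))))))
         (ℤₚ.+-identityʳ _))
coeff-expansion M S (r ∷ L) (suc j) (suc k) eq =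
  trans (coeff-+ₚ (0ℤ ∷ expansion M S L) (expansion M (r ∷ S) L) (suc j))
        (cong₂ _+_ (coeff-expansion M S L j (suc k) (ℕₚ.suc-injective eq))
                   (coeff-expansion M (r ∷ S) L (suc j) k (trans (sym (ℕₚ.+-suc j k)) (ℕₚ.suc-injective eq))))

-- The determinant is linear in row r, which differs from `M r` by x in column r alone. The x-part
-- deletes r, the other part moves r to `S`. Uniqueness ensures that column r does not occur again
-- among the remaining ones.
eval-expansion : ∀ x (u M : I → I → ℤ) → (∀ r → u r r ≡ x + M r r) → (∀ {r c} → r ≢ c → u r c ≡ M r c) →
  ∀ S L → Unique (L ++ S) → minor (map (λ r → u r , r) L ++ map (λ s → M s , s) S) ≡ eval x (expansion M S L)
eval-expansion x u M diag off S []      _ = sym (trans (cong (λ z → principal M S + z) (ℤₚ.*-zeroʳ x)) (ℤₚ.+-identityʳ _))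
eval-expansion x u M diag off S (r ∷ L) (r∉ ∷ uniq) = begin
  u r r * W cs - contract (u r) (W ∘ (r ∷_)) cs
    ≡⟨ cong₂ (λ a b → a * W cs - b) (diag r) (contract-cong cs (All.map off r∉cs) (λ _ → refl)) ⟩
  (x + M r r) * W cs - contract (M r) (W ∘ (r ∷_)) cs
    ≡⟨ lem x (M r r) (W cs) _ ⟩
  0ℤ + x * minor ps + minor ((M r , r) ∷ ps)
    ≡⟨ cong (λ z → 0ℤ + x * minor ps + z) (minor-↭ (↭-sym (Permₚ.shift (M r , r) (map (λ r → u r , r) L) _))) ⟩
  0ℤ + x * minor ps + minor (map (λ r → u r , r) L ++ map (λ s → M s , s) (r ∷ S))
    ≡⟨ cong₂ (λ a b → 0ℤ + x * a + b) (eval-expansion x u M diag off S L uniq) (eval-expansion x u M diag off (r ∷ S) L uniq′) ⟩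
  eval x (0ℤ ∷ expansion M S L) + eval x (expansion M (r ∷ S) L)
    ≡⟨ eval-+ₚ x (0ℤ ∷ expansion M S L) (expansion M (r ∷ S) L) ⟨
  eval x (expansion M S (r ∷ L)) ∎
  where
  open ≡-Reasoning
  ps = map (λ r → u r , r) L ++ map (λ s → M s , s) S
  W = wedge (map proj₁ ps)
  cs = map proj₂ ps
  cs≡ : cs ≡ L ++ S
  cs≡ = trans (Listₚ.map-++ proj₂ (map (λ r → u r , r) L) _)
              (cong₂ _++_ (trans (sym (Listₚ.map-∘ L)) (Listₚ.map-id L)) (trans (sym (Listₚ.map-∘ S)) (Listₚ.map-id S)))
  r∉cs : All (r ≢_) cs
  r∉cs = subst (All (r ≢_)) (sym cs≡) r∉
  uniq′ : Unique (L ++ r ∷ S)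
  uniq′ = PermSetoidₚ.Unique-resp-↭ (setoid _) (Perm.↭⇒↭ₛ (↭-sym (Permₚ.shift r L S))) (r∉ ∷ uniq)
  lem : ∀ x m w z → (x + m) * w - z ≡ 0ℤ + x * w + (m * w - z)
  lem = solve-∀

negEdge : Bool → ℤ
negEdge true  = - 1ℤ
negEdge false = 0ℤ

negAdj : ∀ {n} → Graph n → Fin n → Fin n → ℤ
negAdj G i j = negEdge (adj G i j)

eval-charPoly : ∀ {n} (G : Graph n) x → eval x (charPoly G) ≡ eval x (expansion (negAdj G) [] (allFin n))
eval-charPoly {n} G x = begin
  eval x (charPoly G)                         ≡⟨ eval-normalise x (det n (charEntry G)) ⟩
  eval x (det n (charEntry G))                ≡⟨ eval-det x n (charEntry G) u (λ i → i) (λ _ _ → refl) ⟩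
  wedge (tabulate u) (allFin n)
    ≡⟨ cong₂ wedge (trans (sym (Listₚ.map-∘ (allFin n))) (Listₚ.map-tabulate (λ i → i) u))
                   (trans (sym (Listₚ.map-∘ (allFin n))) (Listₚ.map-id (allFin n))) ⟨
  minor (map (λ r → u r , r) (allFin n))
    ≡⟨ cong minor (Listₚ.++-identityʳ (map (λ r → u r , r) (allFin n))) ⟨
  minor (map (λ r → u r , r) (allFin n) ++ [])
    ≡⟨ eval-expansion x u (negAdj G) diag off [] (allFin n) (subst Unique (sym (Listₚ.++-identityʳ _)) (Uniqueₚ.allFin⁺ n)) ⟩
  eval x (expansion (negAdj G) [] (allFin n)) ∎
  where
  open ≡-Reasoning
  u : Fin n → Fin n → ℤ
  u i j = eval x (charEntry G i j)
  neg-adjMatrix : ∀ i j → - adjMatrix G i j ≡ negAdj G i j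
  neg-adjMatrix i j with adj G i j
  ... | true  = refl
  ... | false = refl
  diag : ∀ r → u r r ≡ x + negAdj G r r
  diag r with r Fin.≟ r
  ... | yes _  = trans (lem (- adjMatrix G r r) x) (cong (λ z → x + z) (neg-adjMatrix r r))
    where
    lem : ∀ a x → a + x * (1ℤ + x * 0ℤ) ≡ x + a
    lem = solve-∀
  ... | no r≢r = contradiction refl r≢r
  off : ∀ {r c} → r ≢ c → u r c ≡ negAdj G r c
  off {r} {c} r≢c with r Fin.≟ c
  ... | yes r≡c = contradiction r≡c r≢c
  ... | no _    = trans (cong (λ z → - adjMatrix G r c + z) (ℤₚ.*-zeroʳ x)) (trans (ℤₚ.+-identityʳ _) (neg-adjMatrix r c))

cospectral⇒coeff : ∀ {m n} (G : Graph m) (H : Graph n) → Cospectral G H →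
  ∀ i → coeff (expansion (negAdj G) [] (allFin m)) i ≡ coeff (expansion (negAdj H) [] (allFin n)) i
cospectral⇒coeff {m} {n} G H co = eval-injective (expansion (negAdj G) [] (allFin m)) (expansion (negAdj H) [] (allFin n)) λ x →
  trans (sym (eval-charPoly G x)) (trans (cong (eval x) co) (eval-charPoly H x))

-- The leading coefficient 1 of the second polynomial sits at position n, beyond the degree of the
-- first if m < n.
cospectral⇒order≤ : ∀ {m n} (G : Graph m) (H : Graph n) → Cospectral G H → n ℕ.≤ m
cospectral⇒order≤ {m} {n} G H co = ℕₚ.≮⇒≥ λ m<n → contradiction
  (trans (sym (coeff-expansion-high (negAdj G) [] (allFin m) n (subst (ℕ._< n) (sym (Listₚ.length-tabulate {n = m} _)) m<n)))
  (trans (cospectral⇒coeff G H co n)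
         (coeff-expansion (negAdj H) [] (allFin n) n 0 (trans (ℕₚ.+-identityʳ n) (sym (Listₚ.length-tabulate {n = n} _))))))
  λ ()

cospectral⇒order≡ : ∀ {m n} (G : Graph m) (H : Graph n) → Cospectral G H → m ≡ n
cospectral⇒order≡ G H co = ℕₚ.≤-antisym (cospectral⇒order≤ H G (sym co)) (cospectral⇒order≤ G H co)

minors : ∀ {n} → Graph n → ℕ → ℤ
minors {n} G k = minorSum (negAdj G) k [] (allFin n)

cospectral⇒minors : ∀ {m n} (G : Graph m) (H : Graph n) → Cospectral G H → ∀ k → minors G k ≡ minors H k
cospectral⇒minors {m} {n} G H co k with cospectral⇒order≡ G H co
... | refl with k ℕ.≤? m
...   | yes k≤m = trans (sym (coeff-expansion (negAdj G) [] (allFin m) (m ℕ.∸ k) k eq))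
                  (trans (cospectral⇒coeff G H co (m ℕ.∸ k)) (coeff-expansion (negAdj H) [] (allFin m) (m ℕ.∸ k) k eq))
  where
  eq : m ℕ.∸ k ℕ.+ k ≡ length (allFin m)
  eq = trans (ℕₚ.m∸n+n≡m k≤m) (sym (Listₚ.length-tabulate _))
...   | no k≰m  = trans (minorSum-high (negAdj G) k [] (allFin m) high) (sym (minorSum-high (negAdj H) k [] (allFin m) high))
  where
  high : length (allFin m) ℕ.< k
  high = subst (ℕ._< k) (sym (Listₚ.length-tabulate _)) (ℕₚ.≰⇒> k≰m)

-- Finite adjacency patterns

-- A graph on k vertices as its strictly triangular adjacency matrix.
Pattern : ℕ → Set
Pattern zero    = ⊤
Pattern (suc k) = Vec Bool k × Pattern k

edge : ∀ {k} → Pattern k → Fin k → Fin k → Bool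
edge {suc k} (r , g) zero    zero    = false
edge {suc k} (r , g) zero    (suc j) = Vec.lookup r j
edge {suc k} (r , g) (suc i) zero    = Vec.lookup r i
edge {suc k} (r , g) (suc i) (suc j) = edge g i j

restrict : (I → I → Bool) → ∀ {k} → Vec I k → Pattern k
restrict A []       = tt
restrict A (v ∷ vs) = Vec.map (A v) vs , restrict A vs

module _ {A : I → I → Bool} (A-sym : ∀ i j → A i j ≡ A j i) (A-irrefl : ∀ i → A i i ≡ false) where

  edge-restrict : ∀ {k} (vs : Vec I k) i j → edge (restrict A vs) i j ≡ A (Vec.lookup vs i) (Vec.lookup vs j)
  edge-restrict (v ∷ vs) zero    zero    = sym (A-irrefl v)
  edge-restrict (v ∷ vs) zero    (suc j) = Vecₚ.lookup-map j (A v) vs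
  edge-restrict (v ∷ vs) (suc i) zero    = trans (Vecₚ.lookup-map i (A v) vs) (A-sym v _)
  edge-restrict (v ∷ vs) (suc i) (suc j) = edge-restrict vs i j

  restrict-map : ∀ {k} (vs : Vec I k) {l} (is : Vec (Fin k) l) →
    restrict (edge (restrict A vs)) is ≡ restrict A (Vec.map (Vec.lookup vs) is)
  restrict-map vs []       = refl
  restrict-map vs (i ∷ is) =
    cong₂ _,_ (trans (Vecₚ.map-cong (edge-restrict vs i) is) (Vecₚ.map-∘ (A (Vec.lookup vs i)) (Vec.lookup vs) is))
              (restrict-map vs is)

-- Contraction with −u that skips the zero entries of u when evaluated.
contractᵇ : (I → Bool) → Form I → Form I
contractᵇ u F []       = 0ℤ
contractᵇ u F (c ∷ cs) = if u c then - F cs - contractᵇ u (F ∘ (c ∷_)) cs else - contractᵇ u (F ∘ (c ∷_)) cs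

wedgeᵇ : (I → I → Bool) → List I → Form I
wedgeᵇ A []       = unit
wedgeᵇ A (r ∷ rs) = contractᵇ (A r) (wedgeᵇ A rs)

contractᵇ-correct : ∀ (u : I → Bool) F cs → contractᵇ u F cs ≡ contract (negEdge ∘ u) F cs
contractᵇ-correct u F []       = refl
contractᵇ-correct u F (c ∷ cs) with u c
... | true  = cong₂ _-_ (sym (ℤₚ.-1*i≡-i (F cs))) (contractᵇ-correct u _ cs)
... | false = trans (cong -_ (contractᵇ-correct u _ cs)) (sym (ℤₚ.+-identityˡ _))

negMatrix : (I → I → Bool) → I → I → ℤ
negMatrix A i j = negEdge (A i j)

wedgeᵇ-correct : ∀ (A : I → I → Bool) rs cs → wedgeᵇ A rs cs ≡ wedge (map (negMatrix A) rs) cs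
wedgeᵇ-correct A []       cs = refl
wedgeᵇ-correct A (r ∷ rs) cs =
  trans (contractᵇ-correct (A r) (wedgeᵇ A rs) cs) (contract-congʳ (negEdge ∘ A r) (wedgeᵇ-correct A rs) cs)

principalᵇ : (I → I → Bool) → List I → ℤ
principalᵇ A is = wedgeᵇ A is is

principalᵇ-correct : ∀ (A : I → I → Bool) is → principalᵇ A is ≡ principal (negMatrix A) is
principalᵇ-correct A is = trans (wedgeᵇ-correct A is is) (sym (principal-wedge (negMatrix A) is))

-- Exhaustive checks over patterns

isZero : ℤ → Bool
isZero (+ zero)  = true
isZero (+ suc _) = false
isZero -[1+ _ ]  = false

isNonPositive : ℤ → Bool
isNonPositive (+ zero)  = true
isNonPositive (+ suc _) = false
isNonPositive -[1+ _ ]  = true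

isNonPositive-sound : ∀ i → isNonPositive i ≡ true → i ≤ 0ℤ
isNonPositive-sound (+ zero)  _ = ℤₚ.≤-refl
isNonPositive-sound -[1+ _ ]  _ = ℤ.-≤+

allMinorsZero : (I → I → Bool) → ℕ → List I → List I → Bool
allMinorsZero A zero    S L       = isZero (principalᵇ A S)
allMinorsZero A (suc k) S []      = true
allMinorsZero A (suc k) S (r ∷ L) = allMinorsZero A (suc k) S L ∧ allMinorsZero A k (r ∷ S) L

-- Patterns that occur in the graph pass the filter, so a search may skip all patterns that fail it.
allMinorsZero-complete : ∀ (A : I → I → Bool) k S L → (∀ is → length is ≡ k ℕ.+ length S → principalᵇ A is ≡ 0ℤ) →
  allMinorsZero A k S L ≡ true
allMinorsZero-complete A zero    S L       h = cong isZero (h S refl)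
allMinorsZero-complete A (suc k) S []      h = refl
allMinorsZero-complete A (suc k) S (r ∷ L) h =
  cong₂ _∧_ (allMinorsZero-complete A (suc k) S L h)
            (allMinorsZero-complete A k (r ∷ S) L (λ is eq → h is (trans eq (ℕₚ.+-suc k (length S)))))

clean : List ℕ → ∀ {k} → Pattern k → Bool
clean ks {k} g = all (λ j → allMinorsZero (edge g) j [] (allFin k)) ks

allVec : ∀ k → (Vec Bool k → Bool) → Bool
allVec zero    P = P []
allVec (suc k) P = allVec k (λ v → P (true ∷ v) ∧ P (false ∷ v))

-- Prunes the search at patterns with a nonzero minor of an order in ks.
allClean : List ℕ → ∀ k → (Pattern k → Bool) → Bool
allClean ks zero    P = P tt
allClean ks (suc k) P = allClean ks k (λ g → if clean ks g then allVec k (λ r → P (r , g)) else true)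

∧-trueˡ : ∀ {a b} → a ∧ b ≡ true → a ≡ true
∧-trueˡ {true} _ = refl

∧-trueʳ : ∀ {a b} → a ∧ b ≡ true → b ≡ true
∧-trueʳ {true} e = e

allVec-sound : ∀ k P → allVec k P ≡ true → ∀ v → P v ≡ true
allVec-sound zero    P e []          = e
allVec-sound (suc k) P e (true ∷ v)  = ∧-trueˡ (allVec-sound k _ e v)
allVec-sound (suc k) P e (false ∷ v) = ∧-trueʳ {P (true ∷ v)} (allVec-sound k _ e v)

-- An implication with its conclusion first: `∨` is lazy, so the final filter runs only where `Q`
-- fails.
cleanCheck : List ℕ → ∀ k → (Pattern k → Bool) → Bool
cleanCheck ks k Q = allClean ks k (λ g → Q g ∨ not (clean ks g))

vertexCheck : List ℕ → ∀ {k} → Pattern k → (Vec Bool k → Bool) → Bool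
vertexCheck ks {k} h Q = allVec k (λ xs → Q xs ∨ not (clean ks (xs , h)))

pairCheck : List ℕ → ∀ {k} → Pattern k → (Vec Bool k → Vec Bool k → Bool → Bool) → Bool
pairCheck ks {k} h Q =
  allVec k λ ys → allVec k λ xs → allVec 1 λ b → Q xs ys (Vec.head b) ∨ not (clean ks ((Vec.head b ∷ xs) , ys , h))

nonPositiveDet : ∀ {k} → Pattern k → Bool
nonPositiveDet {k} g = isNonPositive (principalᵇ (edge g) (allFin k))

-- The triangle gives -2, every other graph on three vertices 0.
det₃-nonPositive : cleanCheck [] 3 nonPositiveDet ≡ true
det₃-nonPositive = refl

-- Without triangles only 5-cycles contribute to the determinant, each of them -2.
det₅-nonPositive : cleanCheck (3 ∷ []) 5 nonPositiveDet ≡ true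
det₅-nonPositive = refl

-- Without 3- and 5-cycles the graph is bipartite, and the minor is 0 or, for sides of size 3 with
-- biadjacency matrix B, minus the square of det B.
det₆-nonPositive : cleanCheck (3 ∷ 5 ∷ []) 6 nonPositiveDet ≡ true
det₆-nonPositive = refl

-- Sign-definite minors

Vanishing : (I → I → ℤ) → ℕ → Set
Vanishing M k = ∀ vs → length vs ≡ k → principal M vs ≡ 0ℤ

NonPositive : (I → I → ℤ) → ℕ → Set
NonPositive M k = ∀ vs → length vs ≡ k → principal M vs ≤ 0ℤ

minorSum-nonPositive : ∀ {M : I → I → ℤ} k S L → NonPositive M (k ℕ.+ length S) → minorSum M k S L ≤ 0ℤ
minorSum-nonPositive zero    S L       h = h S refl
minorSum-nonPositive (suc k) S []      h = ℤₚ.≤-refl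
minorSum-nonPositive {M = M} (suc k) S (r ∷ L) h =
  ℤₚ.+-mono-≤ (minorSum-nonPositive (suc k) S L h)
              (minorSum-nonPositive k (r ∷ S) L (subst (NonPositive M) (sym (ℕₚ.+-suc k (length S))) h))

minorSum≤principal : ∀ {M : I → I → ℤ} vs S L → NonPositive M (length vs ℕ.+ length S) →
  minorSum M (length vs) S (vs ++ L) ≤ principal M (vs ++ S)
minorSum≤principal []       S L h = ℤₚ.≤-refl
minorSum≤principal {M = M} (v ∷ vs) S L h = begin
  minorSum M (suc (length vs)) S (vs ++ L) + minorSum M (length vs) (v ∷ S) (vs ++ L)
    ≤⟨ ℤₚ.+-mono-≤ (minorSum-nonPositive (suc (length vs)) S (vs ++ L) h)
                   (minorSum≤principal vs (v ∷ S) L (subst (NonPositive M) (sym (ℕₚ.+-suc (length vs) (length S))) h)) ⟩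
  0ℤ + principal M (vs ++ v ∷ S)
    ≡⟨ trans (ℤₚ.+-identityˡ _) (principal-↭ M (Permₚ.shift v vs S)) ⟩
  principal M (v ∷ vs ++ S) ∎
  where open ℤₚ.≤-Reasoning

∈⇒↭ : ∀ {v : I} {L} → v ∈ L → ∃ λ L′ → L ↭ v ∷ L′
∈⇒↭ {L = _ ∷ L} (here refl) = L , ↭-refl
∈⇒↭ {L = w ∷ L} (there v∈L) =
  let L′ , p = ∈⇒↭ v∈L in w ∷ L′ , ↭-trans (prep w p) (swap w _ ↭-refl)

repeats-or-extends : ∀ {L : List I} vs → (∀ v → v ∈ L) →
  (∃ λ t → ∃ λ ws → vs ↭ t ∷ t ∷ ws) ⊎ (∃ λ rest → L ↭ vs ++ rest)
repeats-or-extends []       ∈L = inj₂ (_ , ↭-refl)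
repeats-or-extends (v ∷ vs) ∈L with repeats-or-extends vs ∈L
... | inj₁ (t , ws , p) = inj₁ (t , v ∷ ws , ↭-trans (prep v p) (↭-trans (swap v t ↭-refl) (prep t (swap v t ↭-refl))))
... | inj₂ (rest , p) with Memₚ.∈-++⁻ vs (Permₚ.∈-resp-↭ p (∈L v))
...   | inj₁ v∈vs   = let ws , q = ∈⇒↭ v∈vs in inj₁ (v , ws , prep v q)
...   | inj₂ v∈rest = let ws , q = ∈⇒↭ v∈rest in
                      inj₂ (ws , ↭-trans p (↭-trans (Permₚ.++⁺ˡ vs q) (Permₚ.shift v vs ws)))

-- A zero sum of terms ≤ 0 has only zero terms. `Vanishing` also covers lists with repeated
-- vertices, where the minor is 0 anyway; thus patterns can later be read off at tuples of vertices
-- that need not be distinct.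
nonPositive⇒vanishing : ∀ {M : I → I → ℤ} {L} k → (∀ v → v ∈ L) → NonPositive M k → minorSum M k [] L ≡ 0ℤ → Vanishing M k
nonPositive⇒vanishing {M = M} {L} k ∈L h e vs refl with repeats-or-extends vs ∈L
... | inj₁ (t , ws , p) = trans (principal-↭ M p) (principal-repeat M t ws)
... | inj₂ (rest , p)   = ℤₚ.≤-antisym (h vs refl) (begin
  0ℤ                                        ≡⟨ e ⟨
  minorSum M (length vs) [] L               ≡⟨ minorSum-↭ʳ M (length vs) [] p ⟩
  minorSum M (length vs) [] (vs ++ rest)    ≤⟨ minorSum≤principal vs [] rest (subst (NonPositive M) (sym (ℕₚ.+-identityʳ _)) h) ⟩
  principal M (vs ++ [])                    ≡⟨ cong (principal M) (Listₚ.++-identityʳ vs) ⟩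
  principal M vs                            ∎)
  where open ℤₚ.≤-Reasoning

minorSum≢0⇒principal≢0 : ∀ (M : I → I → ℤ) k S L → minorSum M k S L ≢ 0ℤ → ∃ λ vs → length vs ≡ k ℕ.+ length S × principal M vs ≢ 0ℤ
minorSum≢0⇒principal≢0 M zero    S L       ne = S , refl , ne
minorSum≢0⇒principal≢0 M (suc k) S []      ne = contradiction refl ne
minorSum≢0⇒principal≢0 M (suc k) S (r ∷ L) ne with minorSum M (suc k) S L ℤ.≟ 0ℤ
... | no ne′ = minorSum≢0⇒principal≢0 M (suc k) S L ne′
... | yes e  = let vs , l , ne′ = minorSum≢0⇒principal≢0 M k (r ∷ S) L (λ e′ → ne (cong₂ _+_ e e′))
               in vs , trans l (ℕₚ.+-suc k (length S)) , ne′

_≟ᴾ_ : ∀ {k} → DecidableEquality (Pattern k)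
_≟ᴾ_ {zero}  = Unitₚ._≟_
_≟ᴾ_ {suc k} = ×-≡-dec (Vecₚ.≡-dec Boolₚ._≟_) _≟ᴾ_

does-sound : ∀ {P : Set} (P? : Dec P) → does P? ≡ true → P
does-sound (yes p) _ = p

tabulate-lookup-fromList : ∀ (vs : List I) → tabulate (Vec.lookup (fromList vs)) ≡ vs
tabulate-lookup-fromList []       = refl
tabulate-lookup-fromList (v ∷ vs) = cong (v ∷_) (tabulate-lookup-fromList vs)

∨-not-true : ∀ {a b} → a ∨ not b ≡ true → b ≡ true → a ≡ true
∨-not-true {true} e refl = refl

-- Vertex classes around a nonsingular set of four vertices

pathPattern : Pattern 4
pathPattern = (true ∷ false ∷ false ∷ []) , (true ∷ false ∷ []) , (true ∷ []) , [] , tt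

matchingPattern : Pattern 4
matchingPattern = (true ∷ false ∷ false ∷ []) , (false ∷ false ∷ []) , (true ∷ []) , [] , tt

-- The extra vertex 5 is isolated: its class collects the isolated vertices of a blow-up.
P₅ : Fin 6 → Fin 6 → Bool
P₅ 0F 1F = true
P₅ 1F 0F = true
P₅ 1F 2F = true
P₅ 2F 1F = true
P₅ 2F 3F = true
P₅ 3F 2F = true
P₅ 3F 4F = true
P₅ 4F 3F = true
P₅ _  _  = false

-- The class of a vertex, read off from its adjacency to p, q, r, s where p – q – r – s is an induced path
-- (so p, q, r, s have classes 1, 2, 3, 4), resp. where pq and rs form an induced matching (classes 1, 0, 4, 3).
pathClass : Vec Bool 4 → Fin 6
pathClass (true  ∷ false ∷ false ∷ false ∷ []) = 0F
pathClass (false ∷ true  ∷ false ∷ false ∷ []) = 1F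
pathClass (true  ∷ false ∷ true  ∷ false ∷ []) = 2F
pathClass (false ∷ true  ∷ false ∷ true  ∷ []) = 3F
pathClass (false ∷ false ∷ true  ∷ false ∷ []) = 4F
pathClass _                                    = 5F

matchingClass : Vec Bool 4 → Fin 6
matchingClass (true  ∷ false ∷ false ∷ false ∷ []) = 0F
matchingClass (false ∷ true  ∷ false ∷ false ∷ []) = 1F
matchingClass (false ∷ false ∷ true  ∷ false ∷ []) = 3F
matchingClass (false ∷ false ∷ false ∷ true  ∷ []) = 4F
matchingClass _                                    = 5F

onlyFirst onlyLast : Vec Bool 4
onlyFirst = true ∷ false ∷ false ∷ false ∷ []
onlyLast  = false ∷ false ∷ false ∷ true ∷ []

isOnlyFirst isOnlyLast : Vec Bool 4 → Bool
isOnlyFirst xs = does (Vecₚ.≡-dec Boolₚ._≟_ xs onlyFirst)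
isOnlyLast  xs = does (Vecₚ.≡-dec Boolₚ._≟_ xs onlyLast)

meetsBoth : Vec Bool 4 → Bool
meetsBoth (p ∷ q ∷ r ∷ s ∷ []) = (p ∨ q) ∧ (r ∨ s)

singularOrders : List ℕ
singularOrders = 3 ∷ 5 ∷ 6 ∷ []

compatible : (Vec Bool 4 → Bool) → (Vec Bool 4 → Fin 6) → Vec Bool 4 → Vec Bool 4 → Bool → Bool
compatible excluded class xs ys b = (excluded xs ∨ excluded ys) ∨ does (b Boolₚ.≟ P₅ (class xs) (class ys))

oppositeEnds : Vec Bool 4 → Vec Bool 4 → Bool
oppositeEnds xs ys = isOnlyLast xs ∧ isOnlyFirst ys

-- The neighbourhoods on p - q - r - s that survive the filter are ∅, p, q, r, s, pr and qs. Those
-- other than s alone are the five classes and the isolated vertices.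
path-compatible : pairCheck singularOrders pathPattern (compatible isOnlyLast pathClass) ≡ true
path-compatible = refl

-- Such vertices would extend the path at both ends: adjacent to each other they close a 6-cycle,
-- otherwise they give a path on six vertices, and both have nonzero determinant.
path-ends-exclusive : pairCheck singularOrders pathPattern (λ xs ys _ → not (oppositeEnds xs ys)) ≡ true
path-ends-exclusive = refl

-- A vertex that does not meet both edges has at most one neighbour among the four. The graph is
-- then a union of two bicliques and isolated vertices, and the middle class of `P₅` stays empty.
matching-compatible : pairCheck singularOrders matchingPattern (compatible meetsBoth matchingClass) ≡ true
matching-compatible = refl

Contains : ∀ {k l} → Pattern l → Pattern k → List (Vec (Fin k) l) → Set
Contains h g = Any (λ is → restrict (edge g) is ≡ h)

contains? : ∀ {k l} (h : Pattern l) (g : Pattern k) iss → Dec (Contains h g iss)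
contains? h g = Any.any? (λ is → restrict (edge g) is ≟ᴾ h)

-- Vertex 0 is the new one, 12 and 34 are the matching edges. Each entry enters 0 through one edge
-- and leaves to an end of the other, one entry for each choice of the ends that 0 meets.
pathOrders₅ : List (Vec (Fin 5) 4)
pathOrders₅ =
  (2F ∷ 1F ∷ 0F ∷ 3F ∷ []) ∷ (2F ∷ 1F ∷ 0F ∷ 4F ∷ []) ∷ (1F ∷ 2F ∷ 0F ∷ 3F ∷ []) ∷ (1F ∷ 2F ∷ 0F ∷ 4F ∷ []) ∷ []

spansPath : Vec Bool 4 → Bool
spansPath xs = not (meetsBoth xs) ∨ does (contains? pathPattern (xs , matchingPattern) pathOrders₅)

matching-spansPath : vertexCheck singularOrders matchingPattern spansPath ≡ true
matching-spansPath = refl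

-- The twelve orders of four vertices up to reversal, and the three ways to split them into pairs.
pathOrders₄ matchingOrders₄ : List (Vec (Fin 4) 4)
pathOrders₄ =
  (0F ∷ 1F ∷ 2F ∷ 3F ∷ []) ∷ (0F ∷ 1F ∷ 3F ∷ 2F ∷ []) ∷ (0F ∷ 2F ∷ 1F ∷ 3F ∷ []) ∷ (0F ∷ 2F ∷ 3F ∷ 1F ∷ []) ∷
  (0F ∷ 3F ∷ 1F ∷ 2F ∷ []) ∷ (0F ∷ 3F ∷ 2F ∷ 1F ∷ []) ∷ (1F ∷ 0F ∷ 2F ∷ 3F ∷ []) ∷ (1F ∷ 0F ∷ 3F ∷ 2F ∷ []) ∷
  (1F ∷ 2F ∷ 0F ∷ 3F ∷ []) ∷ (1F ∷ 3F ∷ 0F ∷ 2F ∷ []) ∷ (2F ∷ 0F ∷ 1F ∷ 3F ∷ []) ∷ (2F ∷ 1F ∷ 0F ∷ 3F ∷ []) ∷ []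
matchingOrders₄ = (0F ∷ 1F ∷ 2F ∷ 3F ∷ []) ∷ (0F ∷ 2F ∷ 1F ∷ 3F ∷ []) ∷ (0F ∷ 3F ∷ 1F ∷ 2F ∷ []) ∷ []

Singular-or-known : Pattern 4 → Set
Singular-or-known g =
  principalᵇ (edge g) (allFin 4) ≡ 0ℤ ⊎ Contains pathPattern g pathOrders₄ ⊎ Contains matchingPattern g matchingOrders₄

singular-or-known? : ∀ g → Dec (Singular-or-known g)
singular-or-known? g =
  principalᵇ (edge g) (allFin 4) ℤ.≟ 0ℤ ⊎-dec contains? pathPattern g pathOrders₄ ⊎-dec contains? matchingPattern g matchingOrders₄

order₄-singular-or-known : cleanCheck singularOrders 4 (λ g → does (singular-or-known? g)) ≡ true
order₄-singular-or-known = refl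

P₅-blow-up : ∀ {m} → Graph m → Set
P₅-blow-up {m} G = ∃ λ (τ : Fin m → Fin 6) → ∀ x y → adj G x y ≡ P₅ (τ x) (τ y)

-- From pattern checks to the structure of a graph

module _ {m : ℕ} (G : Graph m) where

  private
    V = Fin m
    A = adj G
    M = negAdj G

  pattern-of : ∀ {k} → Vec V k → Pattern k
  pattern-of = restrict A

  principalᵇ-restrict : ∀ {k} (vs : Vec V k) is → principalᵇ (edge (pattern-of vs)) is ≡ principal M (map (Vec.lookup vs) is)
  principalᵇ-restrict vs is =
    trans (principalᵇ-correct (edge (pattern-of vs)) is)
          (sym (principal-map (Vec.lookup vs) M (negMatrix (edge (pattern-of vs)))
                 (λ i j → cong negEdge (edge-restrict (Graph.sym G) (irrefl G) vs i j)) is))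

  clean-restrict : ∀ {ks} → All (Vanishing M) ks → ∀ {k} (vs : Vec V k) → clean ks (pattern-of vs) ≡ true
  clean-restrict []             vs = refl
  clean-restrict {j ∷ _} (h ∷ hs) vs =
    cong₂ _∧_ (allMinorsZero-complete (edge (pattern-of vs)) j [] _ λ is eq →
                 trans (principalᵇ-restrict vs is) (h (map (Vec.lookup vs) is) (trans (Listₚ.length-map (Vec.lookup vs) is) (trans eq (ℕₚ.+-identityʳ j)))))
              (clean-restrict hs vs)

  allClean-sound : ∀ {ks} → All (Vanishing M) ks → ∀ {k} (vs : Vec V k) P → allClean ks k P ≡ true → P (pattern-of vs) ≡ true
  allClean-sound hs []       P e = e
  allClean-sound {ks} hs {suc k} (v ∷ vs) P e
    with clean ks (pattern-of vs) | clean-restrict hs vs | allClean-sound hs vs (λ g → if clean ks g then allVec k (λ r → P (r , g)) else true) e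
  ... | .true | refl | e′ = allVec-sound k _ e′ _

  cleanCheck-sound : ∀ {ks} → All (Vanishing M) ks → ∀ {k} Q → cleanCheck ks k Q ≡ true →
    ∀ (vs : Vec V k) → Q (pattern-of vs) ≡ true
  cleanCheck-sound {ks} hs Q e vs = ∨-not-true (allClean-sound hs vs (λ g → Q g ∨ not (clean ks g)) e) (clean-restrict hs vs)

  bits : ∀ {k} → Vec V k → V → Vec Bool k
  bits vs x = Vec.map (A x) vs

  vertexCheck-sound : ∀ {ks} → All (Vanishing M) ks → ∀ {k} {h : Pattern k} Q → vertexCheck ks h Q ≡ true →
    ∀ vs → pattern-of vs ≡ h → ∀ x → Q (bits vs x) ≡ true
  vertexCheck-sound {ks} hs {k} Q e vs refl x =
    ∨-not-true (allVec-sound k (λ xs → Q xs ∨ not (clean ks (xs , pattern-of vs))) e (bits vs x)) (clean-restrict hs (x ∷ vs))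

  pairCheck-sound : ∀ {ks} → All (Vanishing M) ks → ∀ {k} {h : Pattern k} Q → pairCheck ks h Q ≡ true →
    ∀ vs → pattern-of vs ≡ h → ∀ x y → Q (bits vs x) (bits vs y) (A x y) ≡ true
  pairCheck-sound {ks} hs {k} Q e vs refl x y =
    ∨-not-true (allVec-sound 1 (λ b → Q (bits vs x) (bits vs y) (Vec.head b) ∨ not (clean ks ((Vec.head b ∷ bits vs x) , bits vs y , pattern-of vs)))
                  (allVec-sound k _ (allVec-sound k _ e (bits vs y)) (bits vs x)) (A x y ∷ []))
               (clean-restrict hs (x ∷ y ∷ vs))

  principal-fromList : ∀ vs → principalᵇ (edge (pattern-of (fromList vs))) (allFin (length vs)) ≡ principal M vs
  principal-fromList vs =
    trans (principalᵇ-restrict (fromList vs) (allFin (length vs)))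
          (cong (principal M) (trans (Listₚ.map-tabulate (λ i → i) _) (tabulate-lookup-fromList vs)))

  nonPositive : ∀ {ks} → All (Vanishing M) ks → ∀ {k} → cleanCheck ks k nonPositiveDet ≡ true → NonPositive M k
  nonPositive hs check vs refl =
    subst (_≤ 0ℤ) (principal-fromList vs) (isNonPositive-sound _ (cleanCheck-sound hs nonPositiveDet check (fromList vs)))

  vanishing₃₅₆ : minors G 3 ≡ 0ℤ → minors G 5 ≡ 0ℤ → minors G 6 ≡ 0ℤ → All (Vanishing M) singularOrders
  vanishing₃₅₆ e₃ e₅ e₆ = v₃ ∷ v₅ ∷ v₆ ∷ []
    where
    v₃ = nonPositive⇒vanishing 3 Memₚ.∈-allFin (nonPositive {[]} [] {3} det₃-nonPositive) e₃
    v₅ = nonPositive⇒vanishing 5 Memₚ.∈-allFin (nonPositive {3 ∷ []} (v₃ ∷ []) {5} det₅-nonPositive) e₅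
    v₆ = nonPositive⇒vanishing 6 Memₚ.∈-allFin (nonPositive {3 ∷ 5 ∷ []} (v₃ ∷ v₅ ∷ []) {6} det₆-nonPositive) e₆

  reindex : ∀ {k l} (vs : Vec V k) {h : Pattern l} {iss} → Contains h (pattern-of vs) iss → ∃ λ ws → pattern-of ws ≡ h
  reindex vs c = let is , e = Any.satisfied c in
    Vec.map (Vec.lookup vs) is , trans (sym (restrict-map (Graph.sym G) (irrefl G) vs is)) e

  module _ (vanishing : All (Vanishing M) singularOrders) where

    compatible⇒blow-up : ∀ {h} excluded class → pairCheck singularOrders h (compatible excluded class) ≡ true →
      ∀ vs → pattern-of vs ≡ h → (∀ x → excluded (bits vs x) ≡ false) → P₅-blow-up G
    compatible⇒blow-up {h} excluded class check vs e none = (λ x → class (bits vs x)) , λ x y →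
      does-sound (A x y Boolₚ.≟ P₅ (class (bits vs x)) (class (bits vs y)))
        (drop (none x) (none y) (pairCheck-sound {singularOrders} vanishing {h = h} (compatible excluded class) check vs e x y))
      where
      drop : ∀ {a b c} → a ≡ false → b ≡ false → (a ∨ b) ∨ c ≡ true → c ≡ true
      drop refl refl eq = eq

    blow-up-of-path : ∀ vs → pattern-of vs ≡ pathPattern → P₅-blow-up G
    blow-up-of-path vs@(p ∷ q ∷ r ∷ s ∷ []) e with Finₚ.any? (λ x → isOnlyLast (bits vs x) Boolₚ.≟ true)
    ... | no none = compatible⇒blow-up {pathPattern} isOnlyLast pathClass path-compatible vs e (λ x → Boolₚ.¬-not (λ eq → none (x , eq)))
    -- Here x extends the path beyond s. By `path-ends-exclusive` nothing extends it beyond p, so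
    -- the reversed path has no excluded vertex.
    ... | yes (x , x-last) = compatible⇒blow-up {pathPattern} isOnlyLast pathClass path-compatible (s ∷ r ∷ q ∷ p ∷ [])
      (trans (sym (restrict-map (Graph.sym G) (irrefl G) vs reversal)) (cong (λ g → restrict (edge g) reversal) e))
      (λ y → Boolₚ.¬-not (not-last y))
      where
      reversal : Vec (Fin 4) 4
      reversal = 3F ∷ 2F ∷ 1F ∷ 0F ∷ []
      absurd : ∀ {a b} → a ≡ true → b ≡ true → ¬ not (a ∧ b) ≡ true
      absurd refl refl ()
      reversed : ∀ a b c d → isOnlyLast (d ∷ c ∷ b ∷ a ∷ []) ≡ true → isOnlyFirst (a ∷ b ∷ c ∷ d ∷ []) ≡ true
      reversed true false false false _ = refl
      not-last : ∀ y → isOnlyLast (bits (s ∷ r ∷ q ∷ p ∷ []) y) ≢ true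
      not-last y y-last = absurd x-last (reversed (A y p) (A y q) (A y r) (A y s) y-last)
        (pairCheck-sound {singularOrders} vanishing {h = pathPattern} (λ xs ys _ → not (oppositeEnds xs ys)) path-ends-exclusive vs e x y)

    blow-up-of-matching : ∀ vs → pattern-of vs ≡ matchingPattern → P₅-blow-up G
    blow-up-of-matching vs e with Finₚ.any? (λ x → meetsBoth (bits vs x) Boolₚ.≟ true)
    ... | no none = compatible⇒blow-up {matchingPattern} meetsBoth matchingClass matching-compatible vs e (λ x → Boolₚ.¬-not (λ eq → none (x , eq)))
    -- The vertex x joins the two edges to a path on five vertices, four of which form an induced
    -- path.
    ... | yes (x , both) =
      let ws , eq = reindex (x ∷ vs) (subst (λ g → Contains pathPattern (bits vs x , g) pathOrders₅) (sym e) path)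
      in blow-up-of-path ws eq
      where
      drop : ∀ {a b} → a ≡ true → not a ∨ b ≡ true → b ≡ true
      drop refl eq = eq
      path : Contains pathPattern (bits vs x , matchingPattern) pathOrders₅
      path = does-sound (contains? pathPattern (bits vs x , matchingPattern) pathOrders₅)
        (drop both (vertexCheck-sound {singularOrders} vanishing {h = matchingPattern} spansPath matching-spansPath vs e x))

    order₄-blow-up : ∀ vs → length vs ≡ 4 → principal M vs ≢ 0ℤ → P₅-blow-up G
    order₄-blow-up vs@(_ ∷ _ ∷ _ ∷ _ ∷ []) refl nonsingular =
      [ (λ singular → contradiction (trans (sym (principal-fromList vs)) singular) nonsingular)
      , [ (λ path → let ws , e = reindex (fromList vs) path in blow-up-of-path ws e)
        , (λ matching → let ws , e = reindex (fromList vs) matching in blow-up-of-matching ws e) ]′ ]′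
      (does-sound (singular-or-known? (pattern-of (fromList vs)))
        (cleanCheck-sound {singularOrders} vanishing {4} (λ g → does (singular-or-known? g)) order₄-singular-or-known (fromList vs)))

    blow-up : minors G 4 ≢ 0ℤ → P₅-blow-up G
    blow-up ne = let vs , l , nonsingular = minorSum≢0⇒principal≢0 M 4 [] (allFin m) ne in order₄-blow-up vs l nonsingular

-- Blow-ups of P₅

P₅-sym : ∀ s t → P₅ s t ≡ P₅ t s
P₅-sym = from-yes (Finₚ.all? λ s → Finₚ.all? λ t → P₅ s t Boolₚ.≟ P₅ t s)

P₅-irrefl : ∀ t → P₅ t t ≡ false
P₅-irrefl = from-yes (Finₚ.all? λ t → P₅ t t Boolₚ.≟ false)

classSizes : ∀ {A : Set} → (a b c d e i : A) → List (A × Fin 6)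
classSizes a b c d e i = (a , 0F) ∷ (b , 1F) ∷ (c , 2F) ∷ (d , 3F) ∷ (e , 4F) ∷ (i , 5F) ∷ []

insert-under : ∀ n (s : I) {t L L′} → t ∷ L ↭ L′ → t ∷ replicate n s ++ L ↭ replicate n s ++ L′
insert-under n s {t} {L} p = ↭-trans (↭-sym (Permₚ.shift t (replicate n s) L)) (Permₚ.++⁺ˡ (replicate n s) p)

histogram : ∀ L → ∃ λ a → ∃ λ b → ∃ λ c → ∃ λ d → ∃ λ e → ∃ λ i → L ↭ clones (classSizes a b c d e i)
histogram []       = 0 , 0 , 0 , 0 , 0 , 0 , ↭-refl
histogram (t ∷ L) with histogram L
... | a , b , c , d , e , i , p with t
...   | 0F = suc a , b , c , d , e , i , prep 0F p
...   | 1F = a , suc b , c , d , e , i , ↭-trans (prep 1F p) (insert-under a 0F ↭-refl)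
...   | 2F = a , b , suc c , d , e , i , ↭-trans (prep 2F p) (insert-under a 0F (insert-under b 1F ↭-refl))
...   | 3F = a , b , c , suc d , e , i , ↭-trans (prep 3F p) (insert-under a 0F (insert-under b 1F (insert-under c 2F ↭-refl)))
...   | 4F = a , b , c , d , suc e , i ,
             ↭-trans (prep 4F p) (insert-under a 0F (insert-under b 1F (insert-under c 2F (insert-under d 3F ↭-refl))))
...   | 5F = a , b , c , d , e , suc i ,
             ↭-trans (prep 5F p) (insert-under a 0F (insert-under b 1F (insert-under c 2F (insert-under d 3F (insert-under e 4F ↭-refl)))))

length-clones : ∀ a b c d e i → length (clones (classSizes a b c d e i)) ≡ a ℕ.+ b ℕ.+ c ℕ.+ d ℕ.+ e ℕ.+ i
length-clones a b c d e i = begin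
  length (clones (classSizes a b c d e i))  ≡⟨ step a (step b (step c (step d (step e (step i refl))))) ⟩
  a ℕ.+ (b ℕ.+ (c ℕ.+ (d ℕ.+ (e ℕ.+ (i ℕ.+ 0))))) ≡⟨ lem a b c d e i ⟩
  a ℕ.+ b ℕ.+ c ℕ.+ d ℕ.+ e ℕ.+ i           ∎
  where
  open ≡-Reasoning
  step : ∀ n {t : I} {L k} → length L ≡ k → length (replicate n t ++ L) ≡ n ℕ.+ k
  step n {t} {L} eq = trans (Listₚ.length-++ (replicate n t)) (cong₂ ℕ._+_ (Listₚ.length-replicate n) eq)
  lem : ∀ a b c d e i → a ℕ.+ (b ℕ.+ (c ℕ.+ (d ℕ.+ (e ℕ.+ (i ℕ.+ 0))))) ≡ a ℕ.+ b ℕ.+ c ℕ.+ d ℕ.+ e ℕ.+ i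
  lem = ℕ-Ring.solve-∀

minors-blow-up : ∀ {m} (G : Graph m) (τ : Fin m → Fin 6) → (∀ x y → adj G x y ≡ P₅ (τ x) (τ y)) →
  ∀ {ts} → tabulate τ ↭ clones ts → ∀ k → minors G k ≡ weightedMinorSum (negMatrix P₅) k [] ts
minors-blow-up {m} G τ blow {ts} p k = begin
  minorSum (negAdj G) k [] (allFin m)               ≡⟨ minorSum-map τ (negMatrix P₅) (negAdj G) (λ x y → cong negEdge (blow x y)) k [] (allFin m) ⟨
  minorSum (negMatrix P₅) k [] (map τ (allFin m))    ≡⟨ cong (minorSum (negMatrix P₅) k []) (Listₚ.map-tabulate (λ x → x) τ) ⟩
  minorSum (negMatrix P₅) k [] (tabulate τ)          ≡⟨ minorSum-↭ʳ (negMatrix P₅) k [] p ⟩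
  minorSum (negMatrix P₅) k [] (clones ts)           ≡⟨ minorSum-clones (negMatrix P₅) k [] ts ⟩
  weightedMinorSum (negMatrix P₅) k [] ts           ∎
  where open ≡-Reasoning

module _ where
  open +-*-Solver using (Polynomial; con; _:+_; _:*_; :-_; _:=_; solve)

  -- A copy of `weightedMinorSum` in the syntax of the solver, with the class sizes as variables;
  -- its interpretation unfolds to the original.
  weightedMinorSumₛ : ∀ {v} → ℕ → List (Fin 6) → List (Polynomial v × Fin 6) → Polynomial v
  weightedMinorSumₛ zero    S ts             = con (principal (negMatrix P₅) S)
  weightedMinorSumₛ (suc k) S []             = con 0ℤ
  weightedMinorSumₛ (suc k) S ((n , t) ∷ ts) = weightedMinorSumₛ (suc k) S ts :+ n :* weightedMinorSumₛ k (t ∷ S) ts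

  weightedMinorSum₂ : ∀ a b c d e i → weightedMinorSum (negMatrix P₅) 2 [] (classSizes a b c d e i) ≡
    - (+ a * + b + + b * + c + + c * + d + + d * + e)
  weightedMinorSum₂ a b c d e i =
    solve 6 (λ a b c d e i →
      weightedMinorSumₛ 2 [] (classSizes a b c d e i) :=
      :- (a :* b :+ b :* c :+ c :* d :+ d :* e)) refl (+ a) (+ b) (+ c) (+ d) (+ e) (+ i)

  -- The nonsingular sets of four classes are the two subpaths, giving abcd and bcde, and the
  -- matching that omits the middle class, giving abde. Each has minor 1.
  weightedMinorSum₄ : ∀ a b c d e i → weightedMinorSum (negMatrix P₅) 4 [] (classSizes a b c d e i) ≡
    + b * + d * (+ a * + c + + c * + e + + a * + e)
  weightedMinorSum₄ a b c d e i =
    solve 6 (λ a b c d e i →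
      weightedMinorSumₛ 4 [] (classSizes a b c d e i) :=
      b :* d :* (a :* c :+ c :* e :+ a :* e)) refl (+ a) (+ b) (+ c) (+ d) (+ e) (+ i)

  -- `P₅` is bipartite, so odd orders vanish; order 6 uses the isolated class, whose row is zero.
  weightedMinorSum-zero : ∀ k {a b c d e i} → k ≡ 3 ⊎ k ≡ 5 ⊎ k ≡ 6 →
    weightedMinorSum (negMatrix P₅) k [] (classSizes a b c d e i) ≡ 0ℤ
  weightedMinorSum-zero k {a} {b} {c} {d} {e} {i} = λ where
    (inj₁ refl)        → solve 6 (λ a b c d e i → weightedMinorSumₛ 3 [] (classSizes a b c d e i) := con 0ℤ) refl (+ a) (+ b) (+ c) (+ d) (+ e) (+ i)
    (inj₂ (inj₁ refl)) → solve 6 (λ a b c d e i → weightedMinorSumₛ 5 [] (classSizes a b c d e i) := con 0ℤ) refl (+ a) (+ b) (+ c) (+ d) (+ e) (+ i)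
    (inj₂ (inj₂ refl)) → solve 6 (λ a b c d e i → weightedMinorSumₛ 6 [] (classSizes a b c d e i) := con 0ℤ) refl (+ a) (+ b) (+ c) (+ d) (+ e) (+ i)

-- Double stars

-- Sends the vertices of the double star to the path: leaf, first centre, second centre, the n leaves.
position : ℕ → Fin 4
position 0 = 1F
position 1 = 2F
position 2 = 0F
position (suc (suc (suc _))) = 3F

dsEdge-position : ∀ i j → dsEdge i j ≡ edge pathPattern (position i) (position j)
dsEdge-position 0 0 = refl
dsEdge-position 0 1 = refl
dsEdge-position 0 2 = refl
dsEdge-position 0 (suc (suc (suc _))) = refl
dsEdge-position 1 0 = refl
dsEdge-position 1 1 = refl
dsEdge-position 1 2 = refl
dsEdge-position 1 (suc (suc (suc _))) = refl
dsEdge-position 2 0 = refl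
dsEdge-position 2 1 = refl
dsEdge-position 2 2 = refl
dsEdge-position 2 (suc (suc (suc _))) = refl
dsEdge-position (suc (suc (suc _))) 0 = refl
dsEdge-position (suc (suc (suc _))) 1 = refl
dsEdge-position (suc (suc (suc _))) 2 = refl
dsEdge-position (suc (suc (suc _))) (suc (suc (suc _))) = refl

tabulate-const : ∀ n (t : I) → tabulate {n = n} (λ _ → t) ≡ replicate n t
tabulate-const zero    t = refl
tabulate-const (suc n) t = cong (t ∷_) (tabulate-const n t)

module _ (n : ℕ) (vs : Vec (Fin 6) 4) (vs-path : restrict P₅ vs ≡ pathPattern) where

  -- The path `vs` is a parameter because the solutions found for G occupy the first or the last
  -- four classes, in either direction.
  starClass : Fin (n ℕ.+ 3) → Fin 6
  starClass x = Vec.lookup vs (position (toℕ x))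

  doubleStar-blow-up : ∀ x y → adj (doubleStar1 n) x y ≡ P₅ (starClass x) (starClass y)
  doubleStar-blow-up x y = begin
    dsEdge (toℕ x) (toℕ y)             ≡⟨ dsEdge-position (toℕ x) (toℕ y) ⟩
    edge pathPattern (pos x) (pos y)   ≡⟨ cong (λ g → edge g (pos x) (pos y)) vs-path ⟨
    edge (restrict P₅ vs) (pos x) (pos y) ≡⟨ edge-restrict P₅-sym P₅-irrefl vs (pos x) (pos y) ⟩
    P₅ (starClass x) (starClass y)     ∎
    where
    open ≡-Reasoning
    pos : Fin (n ℕ.+ 3) → Fin 4
    pos = position ∘ toℕ

  starClasses : tabulate starClass ≡
    Vec.lookup vs 1F ∷ Vec.lookup vs 2F ∷ Vec.lookup vs 0F ∷ replicate n (Vec.lookup vs 3F)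
  starClasses = trans (unroll (n ℕ.+ 3) (ℕₚ.+-comm n 3)) (cong (λ L → _ ∷ _ ∷ _ ∷ L) (tabulate-const n (Vec.lookup vs 3F)))
    where
    unroll : ∀ m → m ≡ 3 ℕ.+ n → tabulate {n = m} (λ x → Vec.lookup vs (position (toℕ x))) ≡
      Vec.lookup vs 1F ∷ Vec.lookup vs 2F ∷ Vec.lookup vs 0F ∷ tabulate {n = n} (λ _ → Vec.lookup vs 3F)
    unroll _ refl = refl

minors-doubleStar : ∀ n k → minors (doubleStar1 n) k ≡ weightedMinorSum (negMatrix P₅) k [] (classSizes 1 1 1 n 0 0)
minors-doubleStar n = minors-blow-up (doubleStar1 n) (starClass n vs refl) (doubleStar-blow-up n vs refl)
  (↭-trans (Perm.↭-reflexive (starClasses n vs refl))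
    (↭-trans (Permₚ.shift 0F (1F ∷ 2F ∷ []) (replicate n 3F))
             (Perm.↭-reflexive (cong (λ L → 0F ∷ 1F ∷ 2F ∷ L) (sym (Listₚ.++-identityʳ (replicate n 3F)))))))
  where
  vs : Vec (Fin 6) 4
  vs = 0F ∷ 1F ∷ 2F ∷ 3F ∷ []

-- Recognising the double star

tabulate-↭⇒bijection : ∀ {m n} (f : Fin m → I) (g : Fin n → I) → tabulate f ↭ tabulate g →
  ∃ λ (φ : Fin m ↔ Fin n) → ∀ x → f x ≡ g (Inverse.to φ x)
tabulate-↭⇒bijection {m = m} {n} f g p = (cast-id (sym lf) ∘ₚ onIndices q ∘ₚ cast-id lg) , λ x → begin
  f x                                                ≡⟨ Listₚ.lookup-tabulate f x ⟨
  List.lookup (tabulate f) (Fin.cast (sym lf) x)     ≡⟨ PermSetoidₚ.onIndices-lookup (setoid _) q _ ⟩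
  List.lookup (tabulate g) (σ x)                     ≡⟨ cong (List.lookup (tabulate g)) (Finₚ.cast-involutive (sym lg) lg (σ x)) ⟨
  List.lookup (tabulate g) (Fin.cast (sym lg) (Fin.cast lg (σ x))) ≡⟨ Listₚ.lookup-tabulate g _ ⟩
  g (Fin.cast lg (σ x))                              ∎
  where
  open ≡-Reasoning
  lf = Listₚ.length-tabulate f
  lg = Listₚ.length-tabulate g
  q = Perm.↭⇒↭ₛ p
  σ : Fin m → Fin (length (tabulate g))
  σ x = Inverse.to (onIndices q) (Fin.cast (sym lf) x)

module _ {m n : ℕ} (G : Graph m) (τ : Fin m → Fin 6) (blow : ∀ x y → adj G x y ≡ P₅ (τ x) (τ y)) where

  -- Adjacency in a blow-up depends on classes alone, so any bijection that preserves classes is an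
  -- isomorphism. Equal class sizes, expressed as a permutation of class lists, provide one.
  blow-up⇒isomorphic : ∀ α β γ δ → restrict P₅ (α ∷ β ∷ γ ∷ δ ∷ []) ≡ pathPattern →
    tabulate τ ↭ β ∷ γ ∷ α ∷ replicate n δ → Isomorphic G (doubleStar1 n)
  blow-up⇒isomorphic α β γ δ path p =
    let φ , e = tabulate-↭⇒bijection τ (starClass n vs path) (↭-trans p (Perm.↭-reflexive (sym (starClasses n vs path))))
    in φ , λ x y → trans (blow x y) (trans (cong₂ P₅ (e x) (e y)) (sym (doubleStar-blow-up n vs path (Inverse.to φ x) (Inverse.to φ y))))
    where
    vs : Vec (Fin 6) 4
    vs = α ∷ β ∷ γ ∷ δ ∷ []

  blow-up⇒isomorphicˡ : ∀ α β γ δ → restrict P₅ (α ∷ β ∷ γ ∷ δ ∷ []) ≡ pathPattern →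
    tabulate τ ↭ α ∷ β ∷ γ ∷ replicate n δ ++ [] → Isomorphic G (doubleStar1 n)
  blow-up⇒isomorphicˡ α β γ δ path p = blow-up⇒isomorphic α β γ δ path
    (↭-trans p (↭-trans (Perm.↭-reflexive (cong (λ L → α ∷ β ∷ γ ∷ L) (Listₚ.++-identityʳ (replicate n δ))))
                        (↭-sym (Permₚ.shift α (β ∷ γ ∷ []) (replicate n δ)))))

  blow-up⇒isomorphicʳ : ∀ α β γ δ → restrict P₅ (α ∷ β ∷ γ ∷ δ ∷ []) ≡ pathPattern →
    tabulate τ ↭ replicate n δ ++ γ ∷ β ∷ α ∷ [] → Isomorphic G (doubleStar1 n)
  blow-up⇒isomorphicʳ α β γ δ path p = blow-up⇒isomorphic α β γ δ path
    (↭-trans p (↭-trans (Permₚ.++-comm (replicate n δ) (γ ∷ β ∷ α ∷ [])) (swap γ β ↭-refl)))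

  sizes⇒isomorphic : ∀ {a b c d e i} → DoubleStarSizes n a b c d e i → tabulate τ ↭ clones (classSizes a b c d e i) →
    Isomorphic G (doubleStar1 n)
  sizes⇒isomorphic (first-empty 1-1-1-n) = blow-up⇒isomorphicˡ 1F 2F 3F 4F refl
  sizes⇒isomorphic (first-empty n-1-1-1) = blow-up⇒isomorphicʳ 4F 3F 2F 1F refl
  sizes⇒isomorphic (last-empty 1-1-1-n)  = blow-up⇒isomorphicˡ 0F 1F 2F 3F refl
  sizes⇒isomorphic (last-empty n-1-1-1)  = blow-up⇒isomorphicʳ 3F 2F 1F 0F refl

-- Graphs cospectral with a double star

module _ {m n : ℕ} (G : Graph m) (cospectral : Cospectral G (doubleStar1 n)) where

  minors-cospectral : ∀ k → minors G k ≡ weightedMinorSum (negMatrix P₅) k [] (classSizes 1 1 1 n 0 0)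
  minors-cospectral k = trans (cospectral⇒minors G (doubleStar1 n) cospectral k) (minors-doubleStar n k)

  minors₄ : minors G 4 ≡ + n
  minors₄ = trans (minors-cospectral 4) (trans (weightedMinorSum₄ 1 1 1 n 0 0) (lem (+ n)))
    where
    lem : ∀ n → 1ℤ * n * (1ℤ * 1ℤ + 1ℤ * 0ℤ + 1ℤ * 0ℤ) ≡ n
    lem = solve-∀

  minors₂ : minors G 2 ≡ - (+ n + + 2)
  minors₂ = trans (minors-cospectral 2) (trans (weightedMinorSum₂ 1 1 1 n 0 0) (lem (+ n)))
    where
    lem : ∀ n → - (1ℤ * 1ℤ + 1ℤ * 1ℤ + 1ℤ * n + n * 0ℤ) ≡ - (n + + 2)
    lem = solve-∀

  odd⇒isomorphic : ¬ 2 ∣ n → Isomorphic G (doubleStar1 n)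
  odd⇒isomorphic odd = let a , b , c , d , e , i , p = histogram (tabulate τ) in
    sizes⇒isomorphic G τ blow (double-star-sizes n a b c d e i odd (edges a b c d e i p) (matchings a b c d e i p) (order a b c d e i p)) p
    where
    zero-minors : ∀ k → k ≡ 3 ⊎ k ≡ 5 ⊎ k ≡ 6 → minors G k ≡ 0ℤ
    zero-minors k h = trans (minors-cospectral k) (weightedMinorSum-zero k h)

    vanishing : All (Vanishing (negAdj G)) singularOrders
    vanishing = vanishing₃₅₆ G (zero-minors 3 (inj₁ refl)) (zero-minors 5 (inj₂ (inj₁ refl))) (zero-minors 6 (inj₂ (inj₂ refl)))

    minors₄≢0 : minors G 4 ≢ 0ℤ
    minors₄≢0 eq = odd (subst (2 ∣_) (sym (ℤₚ.+-injective (trans (sym minors₄) eq))) (divides 0 refl))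

    blown : P₅-blow-up G
    blown = blow-up G vanishing minors₄≢0

    τ : Fin m → Fin 6
    τ = proj₁ blown

    blow : ∀ x y → adj G x y ≡ P₅ (τ x) (τ y)
    blow = proj₂ blown

    module _ (a b c d e i : ℕ) (p : tabulate τ ↭ clones (classSizes a b c d e i)) where
      open ≡-Reasoning

      edges : a ℕ.* b ℕ.+ b ℕ.* c ℕ.+ c ℕ.* d ℕ.+ d ℕ.* e ≡ n ℕ.+ 2
      edges = ℤₚ.+-injective (ℤₚ.neg-injective (begin
        - + (a ℕ.* b ℕ.+ b ℕ.* c ℕ.+ c ℕ.* d ℕ.+ d ℕ.* e)
          ≡⟨ cong -_ (cong₂ _+_ (cong₂ _+_ (cong₂ _+_ (ℤₚ.pos-* a b) (ℤₚ.pos-* b c)) (ℤₚ.pos-* c d)) (ℤₚ.pos-* d e)) ⟩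
        - (+ a * + b + + b * + c + + c * + d + + d * + e)
          ≡⟨ weightedMinorSum₂ a b c d e i ⟨
        weightedMinorSum (negMatrix P₅) 2 [] (classSizes a b c d e i)
          ≡⟨ minors-blow-up G τ blow {classSizes a b c d e i} p 2 ⟨
        minors G 2
          ≡⟨ minors₂ ⟩
        - + (n ℕ.+ 2) ∎))

      matchings : b ℕ.* d ℕ.* (a ℕ.* c ℕ.+ c ℕ.* e ℕ.+ a ℕ.* e) ≡ n
      matchings = ℤₚ.+-injective (begin
        + (b ℕ.* d ℕ.* (a ℕ.* c ℕ.+ c ℕ.* e ℕ.+ a ℕ.* e))
          ≡⟨ trans (ℤₚ.pos-* (b ℕ.* d) _) (cong₂ _*_ (ℤₚ.pos-* b d)
               (cong₂ _+_ (cong₂ _+_ (ℤₚ.pos-* a c) (ℤₚ.pos-* c e)) (ℤₚ.pos-* a e))) ⟩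
        + b * + d * (+ a * + c + + c * + e + + a * + e)
          ≡⟨ weightedMinorSum₄ a b c d e i ⟨
        weightedMinorSum (negMatrix P₅) 4 [] (classSizes a b c d e i)
          ≡⟨ minors-blow-up G τ blow {classSizes a b c d e i} p 4 ⟨
        minors G 4
          ≡⟨ minors₄ ⟩
        + n ∎)

      order : a ℕ.+ b ℕ.+ c ℕ.+ d ℕ.+ e ℕ.+ i ≡ n ℕ.+ 3
      order = begin
        a ℕ.+ b ℕ.+ c ℕ.+ d ℕ.+ e ℕ.+ i           ≡⟨ length-clones a b c d e i ⟨
        length (clones (classSizes a b c d e i))  ≡⟨ Permₚ.↭-length p ⟨
        length (tabulate τ)                       ≡⟨ Listₚ.length-tabulate τ ⟩
        m                                         ≡⟨ cospectral⇒order≡ G (doubleStar1 n) cospectral ⟩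
        n ℕ.+ 3                                   ∎

theorem3p10 : (n m : ℕ) (G : Graph m) → Cospectral G (doubleStar1 n) → ¬ Isomorphic G (doubleStar1 n) → 2 ∣ n
theorem3p10 n m G cospectral not-isomorphic =
  decidable-stable (2 ∣? n) (λ odd → not-isomorphic (odd⇒isomorphic G cospectral odd))
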